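{- Let $p$ be a prime, $\mathcal{E}$ a finite family of linear equations over $\mathbb{F}_p$ (as in the context), and $A\subseteq\mathbb{F}_p$ a set avoiding $\mathcal{E}$. There is an absolute constant $c_0>0$ such that the following hold. (1) If $|A|\ge c_0p^{39/47}$, then for every $\kappa_1<\frac{10}{31}$ one has $|A|\le C(\kappa_1)\,p/\mathcal{T}(\mathcal{E})^{\kappa_1}$, and for every $\kappa_2<\frac{3}{10}$ one has $|A|\le C(\kappa_2)\,p/\mathcal{T}_*(\mathcal{E})^{\kappa_2}$, where $C(\kappa)$ depends only on $\kappa$. (2) If $|A|\ge c_0p^{7/9}$ and $\mathcal{T}_*(\mathcal{E})<p^{2/3}$, then for every $\kappa_3<\frac{35}{159}$, $$|A|\le C(\kappa_3)\max\Big\{\frac{p}{\mathcal{T}_*(\mathcal{E})^{\kappa_3}}\Big(\frac{\mathsf{E}^+_*(A)}{|A|^3}\Big)^{22/159},\ \frac{p}{\mathcal{T}_*(\mathcal{E})^{69/183}}\Big\}.$$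
   Context: A family $\mathcal{E}$ consists of $n=|\mathcal{E}|$ equations $a_jx+b_jy+c_jz=d_j$ with $a_j,b_j,c_j\in\mathbb{F}_p^*$, $d_j\in\mathbb{F}_p$, no two coefficient triples proportional. $A$ avoids $\mathcal{E}$ if there are no $j$ and $x,y,z\in A$ with $a_jx+b_jy+c_jz=d_j$. For $k\in\{1,2,3\}$ divide each triple $(a_j,b_j,c_j)$ by its $k$-th coordinate and record the remaining two coordinates as a point $(u^{(k)}_j,v^{(k)}_j)$. $\mathcal{T}(\mathcal{E})=\max_k$ of the maximal size of $J\subseteq\{1,\dots,n\}$ with the $u^{(k)}_j$ ($j\in J$) pairwise distinct and the $v^{(k)}_j$ ($j\in J$) pairwise distinct. $\mathcal{T}_*(\mathcal{E})=\max_k$ of the maximal size of $J$ such that every $j\in J$ has $u^{(k)}_j\neq u^{(k)}_i$ for all $i\in J\setminus\{j\}$, or $v^{(k)}_j\neq v^{(k)}_i$ for all $i\in J\setminus\{j\}$, or $u^{(k)}_j/v^{(k)}_j\neq u^{(k)}_i/v^{(k)}_i$ for all $i\in J\setminus\{j\}$. $\mathsf{E}^+(A)=|\{(a_1,a_2,a_3,a_4)\in A^4: a_1+a_2=a_3+a_4\}|$ and $\mathsf{E}^+_*(A)=\mathsf{E}^+(A)-|A|^4/p$. -}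

module Defs where

open import Data.Nat using (ℕ; zero; suc; _+_; _*_; _∸_; _^_; _≤_; _<_)
open import Data.Nat.DivMod using (_%_)
open import Data.Fin using (Fin; toℕ)
import Data.Fin as Fin
open import Data.Fin.Subset using (Subset; _∈_; ∣_∣)
open import Data.Fin.Subset.Properties using (_∈?_)
open import Data.List using (List; []; _∷_; length; filter; concatMap; map; allFin)
open import Data.Product using (Σ; _×_; _,_)
open import Data.Sum using (_⊎_)
open import Relation.Binary.PropositionalEquality using (_≡_; _≢_)
open import Relation.Nullary using (¬_)
import Data.Nat as ℕ

-- Residue of x modulo p (for p = 0 we return x; never used since p is prime).
md : ℕ → ℕ → ℕ
md zero    x = x
md (suc q) x = x % suc q

-- Elements of F_p are represented by Fin p (their residues 0..p-1).
-- Field inverse in F_p (p prime): x⁻¹ = x^(p-2) mod p  (Fermat).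
inv : (p : ℕ) → ℕ → ℕ
inv p x = md p (x ^ (p ∸ 2))

div : (p : ℕ) → ℕ → ℕ → ℕ
div p x y = md p (x * inv p y)

record Eqn (p : ℕ) : Set where
  constructor eqn
  field
    a b c d : Fin p
open Eqn public

Family : ℕ → ℕ → Set
Family p n = Fin n → Eqn p

Proportional : (p : ℕ) → Eqn p → Eqn p → Set
Proportional p e f = Σ (Fin p) λ l → (toℕ l ≢ 0) ×
  ((md p (toℕ l * toℕ (a e)) ≡ toℕ (a f)) ×
   (md p (toℕ l * toℕ (b e)) ≡ toℕ (b f)) ×
   (md p (toℕ l * toℕ (c e)) ≡ toℕ (c f)))

Admissible : {p n : ℕ} → Family p n → Set
Admissible {p} {n} E =
  ((j : Fin n) → (toℕ (a (E j)) ≢ 0) × (toℕ (b (E j)) ≢ 0) × (toℕ (c (E j)) ≢ 0)) ×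
  ((i j : Fin n) → i ≢ j → ¬ Proportional p (E i) (E j))

Solves : (p : ℕ) → Eqn p → Fin p → Fin p → Fin p → Set
Solves p e x y z =
  md p (toℕ (a e) * toℕ x + toℕ (b e) * toℕ y + toℕ (c e) * toℕ z) ≡ toℕ (d e)

Avoids : {p n : ℕ} → Family p n → Subset p → Set
Avoids {p} {n} E A = (j : Fin n) (x y z : Fin p) →
  x ∈ A → y ∈ A → z ∈ A → ¬ Solves p (E j) x y z

-- Coordinate choice k ∈ {1,2,3}, represented by Fin 3.
-- Point (u^(k), v^(k)): divide the triple by its k-th coordinate, keep the other two.
uk : (p : ℕ) → Fin 3 → Eqn p → ℕ
uk p Fin.zero             e = div p (toℕ (b e)) (toℕ (a e))
uk p (Fin.suc Fin.zero)   e = div p (toℕ (a e)) (toℕ (b e))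
uk p (Fin.suc (Fin.suc _)) e = div p (toℕ (a e)) (toℕ (c e))

vk : (p : ℕ) → Fin 3 → Eqn p → ℕ
vk p Fin.zero             e = div p (toℕ (c e)) (toℕ (a e))
vk p (Fin.suc Fin.zero)   e = div p (toℕ (c e)) (toℕ (b e))
vk p (Fin.suc (Fin.suc _)) e = div p (toℕ (b e)) (toℕ (c e))

GoodT : {p n : ℕ} → Family p n → Fin 3 → Subset n → Set
GoodT {p} {n} E k J = (i j : Fin n) → i ∈ J → j ∈ J → i ≢ j →
  (uk p k (E i) ≢ uk p k (E j)) × (vk p k (E i) ≢ vk p k (E j))

GoodT* : {p n : ℕ} → Family p n → Fin 3 → Subset n → Set
GoodT* {p} {n} E k J = (j : Fin n) → j ∈ J →
  ((i : Fin n) → i ∈ J → i ≢ j → uk p k (E j) ≢ uk p k (E i)) ⊎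
  ((i : Fin n) → i ∈ J → i ≢ j → vk p k (E j) ≢ vk p k (E i)) ⊎
  ((i : Fin n) → i ∈ J → i ≢ j →
      div p (uk p k (E j)) (vk p k (E j)) ≢ div p (uk p k (E i)) (vk p k (E i)))

IsT : {p n : ℕ} → Family p n → ℕ → Set
IsT {p} {n} E t =
  (Σ (Fin 3) λ k → Σ (Subset n) λ J → GoodT E k J × ∣ J ∣ ≡ t) ×
  ((k : Fin 3) (J : Subset n) → GoodT E k J → ∣ J ∣ ≤ t)

IsT* : {p n : ℕ} → Family p n → ℕ → Set
IsT* {p} {n} E t =
  (Σ (Fin 3) λ k → Σ (Subset n) λ J → GoodT* E k J × ∣ J ∣ ≡ t) ×
  ((k : Fin 3) (J : Subset n) → GoodT* E k J → ∣ J ∣ ≤ t)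

elems : {p : ℕ} → Subset p → List (Fin p)
elems {p} A = filter (λ x → x ∈? A) (allFin p)

Eplus : {p : ℕ} → Subset p → ℕ
Eplus {p} A = length (filter (λ q → sumEq q) quads)
  where
  L = elems A
  Q = Fin p × Fin p × Fin p × Fin p
  quads : List Q
  quads = concatMap (λ x1 → concatMap (λ x2 → concatMap (λ x3 →
            map (λ x4 → (x1 , x2 , x3 , x4)) L) L) L) L
  sumEq : (q : Q) → _
  sumEq (x1 , x2 , x3 , x4) = md p (toℕ x1 + toℕ x2) ℕ.≟ md p (toℕ x3 + toℕ x4)

-- Let N = |A| and let E(u) count the solutions of x + uy = x′ + uy′ in A.  If A avoids
-- x + uy + vz = e, then x + uy misses the N residues e − vz, and Cauchy–Schwarz over the
-- remaining p − N residues gives N⁴ + N E(u) ≤ p E(u); for an arbitrary u it gives N⁴ ≤ p E(u).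
-- Two distinct pairs (x, y), (x′, y′) collide for at most one u, so Σᵤ E(u) ≤ p N² + N⁴.
-- Together these allow at most (p / N)³ distinct values of u.  An index set counted by T_* splits
-- into three parts on each of which one of u, v, u / v is injective, so T ≤ T_* ≤ 3 (p / N)³,
-- which is part (1) with the better exponent 1/3.
-- Moreover E(u) ≤ E⁺(A), so a single avoided equation forces p (p E⁺(A) − N⁴) ≥ N⁵.  Hence
-- E⁺_*(A) / N³ ≥ (N / p)², and then the cubic bound already implies the first alternative of (2).

module Submission where

open import Defs
open import Algebra.Bundles using (CommutativeMonoid)
import Algebra.Properties.CommutativeMonoid.Sum as Sum
open import Data.Fin as Fin using (Fin; zero; suc; toℕ; fromℕ<)
open import Data.Fin.Permutation using (Permutation; permutation; _⟨$⟩ʳ_)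
open import Data.Fin.Properties using (_≟_; all?; toℕ<n; toℕ-injective; toℕ-fromℕ<)
open import Data.Integer.Divisibility.Signed using (_∣_; divides; ∣n⇒∣m*n; ∣m∣n⇒∣m+n; ∣⇒∣ᵤ; ∣ᵤ⇒∣)
open import Data.Nat as ℕ using (ℕ; zero; suc)
import Data.Nat.Divisibility as ℕ
import Data.Nat.DivMod as ℕ
import Data.Nat.Properties as ℕ
open import Data.Nat.Coprimality using (prime⇒coprime; coprime-Bézout)
open import Data.Nat.GCD using (module Bézout)
open import Data.Nat.Primality using (Prime; euclidsLemma; ¬prime[0]; ¬prime[1])
open import Data.Product using (Σ; ∃; _×_; _,_; proj₁; proj₂)
open import Data.Sum using (_⊎_; inj₁; inj₂)
open import Level using (0ℓ)
open import Relation.Nullary using (¬_; Dec; yes; no; ¬?; contradiction; _→-dec_)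
open import Relation.Binary.Definitions using (DecidableEquality)
open import Relation.Binary.PropositionalEquality hiding (setoid)
open import Relation.Binary.Structures using (IsEquivalence)
import Relation.Binary.Reasoning.Setoid as SetoidReasoning

-- Arithmetic modulo `p` on the integers.

module Modular (q : ℕ) (pr : Prime (suc q)) where

  open import Data.Integer using (ℤ; +_; _+_; _*_; _-_; -_; ∣_∣; 0ℤ; 1ℤ; -1ℤ; _^_)
  open import Data.Integer.Properties
  open import Data.Integer.DivMod using (_%ℕ_; _/ℕ_; n%ℕd<d; a≡a%ℕn+[a/ℕn]*n)
  open import Data.Integer.Tactic.RingSolver using (solve-∀)

  p : ℕ
  p = suc q

  infix 4 _≋_ _≉_
  -- A record rather than a synonym for divisibility of `x - y`, so that `x` and `y` can be inferred
  -- from the type of a congruence.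
  record _≋_ (x y : ℤ) : Set where
    constructor congruent
    field p∣x-y : + p ∣ x - y
  open _≋_ public

  _≉_ : ℤ → ℤ → Set
  x ≉ y = ¬ x ≋ y

  -- Every congruence below is an integer linear combination of its hypotheses.
  combine₀ : ∀ {x y} k → x - y ≡ k * + p → x ≋ y
  combine₀ k eq = congruent (divides k eq)

  combine₁ : ∀ {a b x y} k → a ≋ b → x - y ≡ k * (a - b) → x ≋ y
  combine₁ k a≋b eq = congruent (subst (+ p ∣_) (sym eq) (∣n⇒∣m*n k (p∣x-y a≋b)))

  combine₂ : ∀ {a b c d x y} k l → a ≋ b → c ≋ d → x - y ≡ k * (a - b) + l * (c - d) → x ≋ y
  combine₂ k l a≋b c≋d eq = congruent (subst (+ p ∣_) (sym eq)
    (∣m∣n⇒∣m+n (∣n⇒∣m*n k (p∣x-y a≋b)) (∣n⇒∣m*n l (p∣x-y c≋d))))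

  combine₃ : ∀ {a b c d e f x y} k l m → a ≋ b → c ≋ d → e ≋ f →
             x - y ≡ k * (a - b) + l * (c - d) + m * (e - f) → x ≋ y
  combine₃ k l m a≋b c≋d e≋f eq = congruent (subst (+ p ∣_) (sym eq) (∣m∣n⇒∣m+n
    (∣m∣n⇒∣m+n (∣n⇒∣m*n k (p∣x-y a≋b)) (∣n⇒∣m*n l (p∣x-y c≋d))) (∣n⇒∣m*n m (p∣x-y e≋f))))

  ≋-reflexive : ∀ {x y} → x ≡ y → x ≋ y
  ≋-reflexive {x} refl = combine₀ 0ℤ (+-inverseʳ x)

  ≋-refl : ∀ {x} → x ≋ x
  ≋-refl = ≋-reflexive refl

  ≋-sym : ∀ {x y} → x ≋ y → y ≋ x
  ≋-sym {x} {y} x≋y = combine₁ -1ℤ x≋y (eq x y)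
    where
    eq : ∀ x y → y - x ≡ -1ℤ * (x - y)
    eq = solve-∀

  ≋-trans : ∀ {x y z} → x ≋ y → y ≋ z → x ≋ z
  ≋-trans {x} {y} {z} x≋y y≋z = combine₂ 1ℤ 1ℤ x≋y y≋z (eq x y z)
    where
    eq : ∀ x y z → x - z ≡ 1ℤ * (x - y) + 1ℤ * (y - z)
    eq = solve-∀

  ≋-isEquivalence : IsEquivalence _≋_
  ≋-isEquivalence = record { refl = ≋-refl ; sym = ≋-sym ; trans = ≋-trans }

  *-cong : ∀ {a b c d} → a ≋ b → c ≋ d → a * c ≋ b * d
  *-cong {a} {b} {c} {d} a≋b c≋d = combine₂ c b a≋b c≋d (eq a b c d)
    where
    eq : ∀ a b c d → a * c - b * d ≡ c * (a - b) + b * (c - d)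
    eq = solve-∀

  *-congˡ : ∀ a {c d} → c ≋ d → a * c ≋ a * d
  *-congˡ a {c} {d} = *-cong {a} {a} {c} {d} ≋-refl

  *-commutativeMonoid : CommutativeMonoid 0ℓ 0ℓ
  *-commutativeMonoid = record
    { Carrier = ℤ ; _≈_ = _≋_ ; _∙_ = _*_ ; ε = 1ℤ
    ; isCommutativeMonoid = record
      { isMonoid = record
        { isSemigroup = record
          { isMagma = record { isEquivalence = ≋-isEquivalence ; ∙-cong = *-cong }
          ; assoc = λ x y z → ≋-reflexive (*-assoc x y z) }
        ; identity = (λ x → ≋-reflexive (*-identityˡ x)) , (λ x → ≋-reflexive (*-identityʳ x)) }
      ; comm = λ x y → ≋-reflexive (*-comm x y) } }

  open CommutativeMonoid *-commutativeMonoid using (setoid)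
  module ≋-Reasoning = SetoidReasoning setoid
  open Sum *-commutativeMonoid using () renaming
    (sum to ∏; ∑-distrib-+ to ∏-distrib-*; sum-permute to ∏-permute; sum-cong-≋ to ∏-cong)

  *≋0 : ∀ x y → x * y ≋ 0ℤ → x ≋ 0ℤ ⊎ y ≋ 0ℤ
  *≋0 x y xy≋0 with euclidsLemma ∣ x ∣ ∣ y ∣ pr
                      (subst (p ℕ.∣_) (trans (cong ∣_∣ (+-identityʳ (x * y))) (abs-* x y)) (∣⇒∣ᵤ (p∣x-y xy≋0)))
  ... | inj₁ p∣x = inj₁ (congruent (subst (+ p ∣_) (sym (+-identityʳ x)) (∣ᵤ⇒∣ p∣x)))
  ... | inj₂ p∣y = inj₂ (congruent (subst (+ p ∣_) (sym (+-identityʳ y)) (∣ᵤ⇒∣ p∣y)))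

  *-≉0 : ∀ {x y} → x ≉ 0ℤ → y ≉ 0ℤ → x * y ≉ 0ℤ
  *-≉0 {x} {y} x≉0 y≉0 xy≋0 with *≋0 x y xy≋0
  ... | inj₁ x≋0 = x≉0 x≋0
  ... | inj₂ y≋0 = y≉0 y≋0

  *-cancelˡ : ∀ {a x y} → a ≉ 0ℤ → a * x ≋ a * y → x ≋ y
  *-cancelˡ {a} {x} {y} a≉0 ax≋ay with *≋0 a (x - y) (combine₁ 1ℤ ax≋ay (eq a x y))
    where
    eq : ∀ a x y → a * (x - y) - 0ℤ ≡ 1ℤ * (a * x - a * y)
    eq = solve-∀
  ... | inj₁ a≋0 = contradiction a≋0 a≉0
  ... | inj₂ x-y≋0 = combine₁ 1ℤ x-y≋0 (eq x y)
    where
    eq : ∀ x y → x - y ≡ 1ℤ * ((x - y) - 0ℤ)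
    eq = solve-∀

  -- Two numbers below `p` differ by less than `p`, and 0 is the only multiple of `p` of such small
  -- absolute value.
  +-injective-< : ∀ {m n} → m ℕ.< p → n ℕ.< p → + m ≋ + n → m ≡ n
  +-injective-< {m} {n} m<p n<p m≋n = +-injective (i-j≡0⇒i≡j (+ m) (+ n) (∣i∣≡0⇒i≡0 diff≡0))
    where
    diff<p : ∣ + m - + n ∣ ℕ.< p
    diff<p = ℕ.≤-<-trans (subst (ℕ._≤ m ℕ.⊔ n) (cong ∣_∣ (sym (m-n≡m⊖n m n))) (∣m⊝n∣≤m⊔n m n)) (ℕ.⊔-lub m<p n<p)
    diff≡0 : ∣ + m - + n ∣ ≡ 0
    diff≡0 with ∣ + m - + n ∣ | diff<p | ∣⇒∣ᵤ (p∣x-y m≋n)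
    ... | zero  | _   | _   = refl
    ... | suc d | d<p | p∣d = contradiction (ℕ.∣⇒≤ p∣d) (ℕ.<⇒≱ d<p)

  ι : Fin p → ℤ
  ι x = + toℕ x

  ι-injective : ∀ {x y} → ι x ≋ ι y → x ≡ y
  ι-injective {x} {y} x≋y = toℕ-injective (+-injective-< (toℕ<n x) (toℕ<n y) x≋y)

  ι≉0 : ∀ {x} → toℕ x ≢ 0 → ι x ≉ 0ℤ
  ι≉0 {x} x≢0 x≋0 = x≢0 (+-injective-< (toℕ<n x) (ℕ.s≤s ℕ.z≤n) x≋0)

  res : ℤ → Fin p
  res z = fromℕ< (n%ℕd<d z p)

  ι-res : ∀ z → ι (res z) ≋ z
  ι-res z = combine₀ (- (z /ℕ p)) (trans (cong₂ (λ r y → + r - y) (toℕ-fromℕ< (n%ℕd<d z p)) (a≡a%ℕn+[a/ℕn]*n z p))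
      (eq (+ (z %ℕ p)) (z /ℕ p) (+ p)))
    where
    eq : ∀ r k n → r - (r + k * n) ≡ - k * n
    eq = solve-∀

  res-cong : ∀ {x y} → x ≋ y → res x ≡ res y
  res-cong {x} {y} x≋y = ι-injective (≋-trans (ι-res x) (≋-trans x≋y (≋-sym (ι-res y))))

  res-injective : ∀ {x y} → res x ≡ res y → x ≋ y
  res-injective {x} {y} eq = ≋-trans (≋-sym (ι-res x)) (≋-trans (≋-reflexive (cong ι eq)) (ι-res y))

  md<p : ∀ m → md p m ℕ.< p
  md<p m = ℕ.m%n<n m p

  +md : ∀ m → + md p m ≋ + m
  +md m = ≋-trans (≋-reflexive (cong +_ (sym (toℕ-fromℕ< (n%ℕd<d (+ m) p))))) (ι-res (+ m))

  -- The residue i of `a` is positive and below the prime `p`, hence coprime to it. Bézout's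
  -- identity over the naturals has two sign patterns: 1 + y i = x p yields the inverse -y, and 1 +
  -- x p = y i yields y.
  inverse : ∀ {a} → a ≉ 0ℤ → ∃ λ b → a * b ≋ 1ℤ
  inverse {a} a≉0 with res a in eq
  ... | zero = contradiction (≋-trans (≋-sym (ι-res a)) (≋-reflexive (cong ι eq))) a≉0
  ... | suc i with coprime-Bézout (prime⇒coprime pr (toℕ<n (suc i)))
  ...   | Bézout.+- x y e = - + y ,
          ≋-trans (*-cong a≋ ≋-refl) (combine₀ (- + x) (trans (lin (+ suc (toℕ i)) (+ y))
            (trans (cong -_ (trans (sym (e′ e)) (pos-* x p))) (neg-distribˡ-* (+ x) (+ p)))))
    where
    a≋ = ≋-trans (≋-sym (ι-res a)) (≋-reflexive (cong ι eq))
    lin : ∀ a y → a * (- y) - 1ℤ ≡ - (1ℤ + y * a)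
    lin = solve-∀
    e′ : 1 ℕ.+ y ℕ.* suc (toℕ i) ≡ x ℕ.* p → + (x ℕ.* p) ≡ 1ℤ + + y * + suc (toℕ i)
    e′ e = trans (cong +_ (sym e)) (trans (pos-+ 1 _) (cong (λ z → 1ℤ + z) (pos-* y _)))
  ...   | Bézout.-+ x y e = + y ,
          ≋-trans (*-cong a≋ ≋-refl) (combine₀ (+ x) (trans (lin (+ suc (toℕ i)) (+ y))
            (trans (cong (λ z → z - 1ℤ) (e′ e)) (lin′ (+ x * + p)))))
    where
    a≋ = ≋-trans (≋-sym (ι-res a)) (≋-reflexive (cong ι eq))
    lin : ∀ a y → a * y - 1ℤ ≡ y * a - 1ℤ
    lin = solve-∀
    lin′ : ∀ z → (1ℤ + z) - 1ℤ ≡ z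
    lin′ = solve-∀
    e′ : 1 ℕ.+ x ℕ.* p ≡ y ℕ.* suc (toℕ i) → + y * + suc (toℕ i) ≡ 1ℤ + + x * + p
    e′ e = trans (sym (pos-* y _)) (trans (cong +_ (sym e)) (trans (pos-+ 1 _) (cong (λ z → 1ℤ + z) (pos-* x p))))

  -- Multiplication by a permutes the nonzero residues, hence fixes their product.
  fermat : ∀ {a} → a ≉ 0ℤ → a ^ q ≋ 1ℤ
  fermat {a} a≉0 with inverse a≉0
  ... | b , ab≋1 = *-cancelˡ ∏g≉0 (begin
      ∏ g * a ^ q          ≡⟨ *-comm (∏ g) (a ^ q) ⟩
      a ^ q * ∏ g          ≡⟨ cong (_* ∏ g) (trans (*-identityˡ _) (∏-replicate q)) ⟨
      ∏ h * ∏ g            ≈⟨ ∏-distrib-* h g ⟨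
      ∏ (λ i → h i * g i)  ≈⟨ ∏-cong permuted ⟩
      ∏ (λ i → g (π ⟨$⟩ʳ i)) ≈⟨ ∏-permute g π ⟨
      ∏ g                  ≡⟨ *-identityʳ (∏ g) ⟨
      ∏ g * 1ℤ             ∎)
    where
    open ≋-Reasoning
    -- Index 0 carries the factor 1 in both functions. The products then run over the nonzero
    -- residues only, while `π`, which fixes 0, can act on all of `Fin p`.
    g h : Fin p → ℤ
    g zero    = 1ℤ
    g (suc i) = ι (suc i)
    h zero    = 1ℤ
    h (suc i) = a
    times : ∀ c d → c * d ≋ 1ℤ → ∀ x → res (c * ι (res (d * ι x))) ≡ x
    times c d cd≋1 x = ι-injective (≋-trans (ι-res (c * ι (res (d * ι x))))
      (combine₂ c (ι x) (ι-res (d * ι x)) cd≋1 (eq c d (ι x) (ι (res (d * ι x))))))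
      where
      eq : ∀ c d x y → c * y - x ≡ c * (y - d * x) + x * (c * d - 1ℤ)
      eq = solve-∀
    π : Permutation p p
    π = permutation (λ x → res (a * ι x)) (λ x → res (b * ι x))
          (times a b ab≋1) (times b a (≋-trans (≋-reflexive (*-comm b a)) ab≋1))
    ∏-replicate : ∀ n → ∏ {n} (λ _ → a) ≡ a ^ n
    ∏-replicate zero    = refl
    ∏-replicate (suc n) = cong (a *_) (∏-replicate n)
    1≉0 : 1ℤ ≉ 0ℤ
    1≉0 1≋0 = a≉0 (combine₁ a 1≋0 (eq a))
      where
      eq : ∀ a → a - 0ℤ ≡ a * (1ℤ - 0ℤ)
      eq = solve-∀
    ∏≉0 : ∀ {n} {f : Fin n → ℤ} → (∀ i → f i ≉ 0ℤ) → ∏ f ≉ 0ℤ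
    ∏≉0 {zero}  f≉0 = 1≉0
    ∏≉0 {suc n} f≉0 = *-≉0 (f≉0 zero) (∏≉0 (λ i → f≉0 (suc i)))
    ∏g≉0 : ∏ g ≉ 0ℤ
    ∏g≉0 = ∏≉0 g≉0
      where
      g≉0 : ∀ i → g i ≉ 0ℤ
      g≉0 zero    = 1≉0
      g≉0 (suc i) = ι≉0 λ ()
    g≋ι : ∀ x → ι x ≉ 0ℤ → g x ≋ ι x
    g≋ι zero    0≉0 = contradiction ≋-refl 0≉0
    g≋ι (suc i) _   = ≋-refl
    permuted : ∀ i → h i * g i ≋ g (π ⟨$⟩ʳ i)
    permuted zero    = ≋-reflexive (sym (cong g (trans (res-cong (≋-reflexive (*-zeroʳ a))) (ι-injective (ι-res 0ℤ)))))
    permuted (suc i) = ≋-sym (≋-trans (g≋ι _ nonzero) (ι-res _))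
      where
      nonzero : ι (res (a * ι (suc i))) ≉ 0ℤ
      nonzero r≋0 = *-≉0 a≉0 (ι≉0 λ ()) (≋-trans (≋-sym (ι-res _)) r≋0)

  pos-^ : ∀ m n → + (m ℕ.^ n) ≡ (+ m) ^ n
  pos-^ m zero    = refl
  pos-^ m (suc n) = trans (pos-* m (m ℕ.^ n)) (cong (λ z → + m * z) (pos-^ m n))

  -- `inv` is the power with exponent `p ∸ 2`, so the product is the `q`-th power and `fermat`
  -- applies. The split on `q` excludes `p` = 1, where the truncated subtraction would break this
  -- count.
  *-inv : ∀ {m} → + m ≉ 0ℤ → + m * + inv p m ≋ 1ℤ
  *-inv {m} m≉0 = go q refl
    where
    go : ∀ r → r ≡ q → + m * + inv p m ≋ 1ℤ
    go zero    refl = contradiction pr ¬prime[1]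
    go (suc r) refl = ≋-trans
      (*-congˡ (+ m) (≋-trans (+md (m ℕ.^ r)) (≋-reflexive (pos-^ m r))))
      (fermat m≉0)

  *-div : ∀ {m n} → + n ≉ 0ℤ → + n * + div p m n ≋ + m
  *-div {m} {n} n≉0 = ≋-trans (*-congˡ (+ n) (≋-trans (+md (m ℕ.* inv p n)) (≋-reflexive (pos-* m (inv p n)))))
    (combine₁ (+ m) (*-inv {n} n≉0) (eq (+ n) (+ m) (+ inv p n)))
    where
    eq : ∀ n m i → n * (m * i) - m ≡ m * (n * i - 1ℤ)
    eq = solve-∀

open import Data.Fin.Subset using (Subset; inside; outside; ∣_∣) renaming (_∈_ to _∈ₛ_)
open import Data.Fin.Subset.Properties using (_∈?_; drop-there; ∣p∣≤n)
open import Data.List using (List; []; _∷_; _++_; length; filter; concatMap; map; allFin; cartesianProduct)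
open import Data.List.Properties using (map-++; map-∘; map-tabulate; length-tabulate)
open import Data.List.Membership.Propositional using (_∈_; find; lose)
open import Data.List.Membership.Propositional.Properties using (∈-allFin; ∈-filter⁻; ∈-cartesianProduct⁻)
open import Data.List.Relation.Unary.Any using (here; there; any?)
import Data.List.Relation.Unary.All as All
open import Data.List.Relation.Unary.AllPairs using ([]; _∷_)
open import Data.List.Relation.Unary.Unique.Propositional using (Unique)
open import Data.List.Relation.Unary.Unique.Propositional.Properties using (allFin⁺; filter⁺; cartesianProduct⁺)
open import Data.Nat using (_+_; _*_; _∸_; _^_; _≤_; _<_; z≤n; s≤s)
open import Data.Nat.ListAction using (sum)
open import Data.Nat.ListAction.Properties using (sum-++)
open import Data.Nat.Properties hiding (_≟_)
open import Data.Nat.Tactic.RingSolver using (solve-∀)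
open import Data.Product.Properties using (≡-dec)
open import Data.Vec using ([]; _∷_; here; there)
open import Function using (_∘_)
open import Relation.Unary using (Decidable)

-- Finite sums over lists, and indicators.

private
  variable
    X Y P Q : Set

∑ : List X → (X → ℕ) → ℕ
∑ xs f = sum (map f xs)

∑-mono : (xs : List X) {f g : X → ℕ} → (∀ {x} → x ∈ xs → f x ≤ g x) → ∑ xs f ≤ ∑ xs g
∑-mono []       h = z≤n
∑-mono (x ∷ xs) h = +-mono-≤ (h (here refl)) (∑-mono xs λ x∈ → h (there x∈))

∑-cong : (xs : List X) {f g : X → ℕ} → (∀ x → f x ≡ g x) → ∑ xs f ≡ ∑ xs g
∑-cong []       h = refl
∑-cong (x ∷ xs) h = cong₂ _+_ (h x) (∑-cong xs h)

∑-+ : (xs : List X) (f g : X → ℕ) → ∑ xs (λ x → f x + g x) ≡ ∑ xs f + ∑ xs g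
∑-+ []       f g = refl
∑-+ (x ∷ xs) f g = trans (cong (f x + g x +_) (∑-+ xs f g)) (interchange (f x) (g x) (∑ xs f) (∑ xs g))
  where
  interchange : ∀ a b c d → a + b + (c + d) ≡ a + c + (b + d)
  interchange = solve-∀

∑-*ˡ : (xs : List X) (c : ℕ) (f : X → ℕ) → ∑ xs (λ x → c * f x) ≡ c * ∑ xs f
∑-*ˡ []       c f = sym (*-zeroʳ c)
∑-*ˡ (x ∷ xs) c f = trans (cong (c * f x +_) (∑-*ˡ xs c f)) (sym (*-distribˡ-+ c (f x) (∑ xs f)))

∑-*ʳ : (xs : List X) (c : ℕ) (f : X → ℕ) → ∑ xs (λ x → f x * c) ≡ ∑ xs f * c
∑-*ʳ xs c f = trans (∑-cong xs λ x → *-comm (f x) c) (trans (∑-*ˡ xs c f) (*-comm c (∑ xs f)))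

∑-const : (xs : List X) (c : ℕ) → ∑ xs (λ _ → c) ≡ length xs * c
∑-const []       c = refl
∑-const (x ∷ xs) c = cong (c +_) (∑-const xs c)

∑-comm : (xs : List X) (ys : List Y) (f : X → Y → ℕ) →
         ∑ xs (λ x → ∑ ys (f x)) ≡ ∑ ys (λ y → ∑ xs (λ x → f x y))
∑-comm []       ys f = sym (trans (∑-const ys 0) (*-zeroʳ (length ys)))
∑-comm (x ∷ xs) ys f = trans (cong (∑ ys (f x) +_) (∑-comm xs ys f)) (sym (∑-+ ys (f x) _))

∑-*-∑ : (xs : List X) (ys : List Y) (f : X → ℕ) (g : Y → ℕ) →
        ∑ xs (λ x → ∑ ys (λ y → f x * g y)) ≡ ∑ xs f * ∑ ys g
∑-*-∑ xs ys f g = trans (∑-cong xs λ x → ∑-*ˡ ys (f x) g) (∑-*ʳ xs (∑ ys g) f)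

∑-++ : (xs ys : List X) (f : X → ℕ) → ∑ (xs ++ ys) f ≡ ∑ xs f + ∑ ys f
∑-++ xs ys f = trans (cong sum (map-++ f xs ys)) (sum-++ (map f xs) (map f ys))

∑-map : (g : X → Y) (xs : List X) (f : Y → ℕ) → ∑ (map g xs) f ≡ ∑ xs (λ x → f (g x))
∑-map g xs f = cong sum (sym (map-∘ xs))

∑-cartesianProduct : (xs : List X) (ys : List Y) (f : X × Y → ℕ) →
                     ∑ (cartesianProduct xs ys) f ≡ ∑ xs (λ x → ∑ ys (λ y → f (x , y)))
∑-cartesianProduct []       ys f = refl
∑-cartesianProduct (x ∷ xs) ys f = trans (∑-++ (map (x ,_) ys) _ f)
  (cong₂ _+_ (∑-map (x ,_) ys f) (∑-cartesianProduct xs ys f))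

f≤∑ : {xs : List X} (f : X → ℕ) {x : X} → x ∈ xs → f x ≤ ∑ xs f
f≤∑ f (here refl) = m≤m+n _ _
f≤∑ f (there x∈)  = ≤-trans (f≤∑ f x∈) (m≤n+m _ _)

⟦_⟧ : Dec P → ℕ
⟦ yes _ ⟧ = 1
⟦ no  _ ⟧ = 0

⟦⟧≤1 : (P? : Dec P) → ⟦ P? ⟧ ≤ 1
⟦⟧≤1 (yes _) = ≤-refl
⟦⟧≤1 (no  _) = z≤n

⟦⟧-true : (P? : Dec P) → P → ⟦ P? ⟧ ≡ 1
⟦⟧-true (yes _) _ = refl
⟦⟧-true (no ¬p) p = contradiction p ¬p

⟦⟧-false : (P? : Dec P) → ¬ P → ⟦ P? ⟧ ≡ 0
⟦⟧-false (yes p) ¬p = contradiction p ¬p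
⟦⟧-false (no  _) _  = refl

⟦⟧≤ : {n : ℕ} (P? : Dec P) → (P → 1 ≤ n) → ⟦ P? ⟧ ≤ n
⟦⟧≤ (yes p) h = h p
⟦⟧≤ (no  _) _ = z≤n

⟦⟧-mono : (P? : Dec P) (Q? : Dec Q) → (P → Q) → ⟦ P? ⟧ ≤ ⟦ Q? ⟧
⟦⟧-mono P? Q? h = ⟦⟧≤ P? λ p → ≤-reflexive (sym (⟦⟧-true Q? (h p)))

∑⟦⟧≤1 : {R : X → Set} (R? : Decidable R) {xs : List X} → Unique xs →
        (∀ {x y} → x ∈ xs → y ∈ xs → R x → R y → x ≡ y) → ∑ xs (λ x → ⟦ R? x ⟧) ≤ 1
∑⟦⟧≤1 R? []             _   = z≤n
∑⟦⟧≤1 {R = R} R? {x ∷ xs} (x∉ ∷ xs!) inj with R? x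
... | no  _  = ∑⟦⟧≤1 R? xs! λ x∈ y∈ → inj (there x∈) (there y∈)
... | yes rx = s≤s (≤-trans (∑-mono xs none) (≤-reflexive (trans (∑-const xs 0) (*-zeroʳ (length xs)))))
  where
  none : ∀ {y} → y ∈ xs → ⟦ R? y ⟧ ≤ 0
  none {y} y∈ = ⟦⟧≤ (R? y) λ ry →
    contradiction (inj (here refl) (there y∈) rx ry) (All.lookup x∉ y∈)

length-filter-∑ : {R : X → Set} (R? : Decidable R) (xs : List X) →
                  length (filter R? xs) ≡ ∑ xs (λ x → ⟦ R? x ⟧)
length-filter-∑ R? []       = refl
length-filter-∑ R? (x ∷ xs) with R? x
... | yes _ = cong suc (length-filter-∑ R? xs)
... | no  _ = length-filter-∑ R? xs

∑-concatMap : (g : X → List Y) (xs : List X) (f : Y → ℕ) →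
              ∑ (concatMap g xs) f ≡ ∑ xs (λ x → ∑ (g x) f)
∑-concatMap g []       f = refl
∑-concatMap g (x ∷ xs) f = trans (∑-++ (g x) _ f) (cong (∑ (g x) f +_) (∑-concatMap g xs f))

-- Induction without subtraction: passing from `x`, `y` to their successors adds 2x + 2y + 2 to both
-- sides.
2xy≤x²+y² : ∀ x y → 2 * (x * y) ≤ x * x + y * y
2xy≤x²+y² zero    y       = z≤n
2xy≤x²+y² (suc x) zero    = ≤-trans (≤-reflexive (cong (2 *_) (*-zeroʳ (suc x)))) z≤n
2xy≤x²+y² (suc x) (suc y) = begin
  2 * (suc x * suc y)               ≡⟨ lhs x y ⟩
  2 * (x * y) + (2 * x + 2 * y + 2) ≤⟨ +-monoˡ-≤ _ (2xy≤x²+y² x y) ⟩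
  x * x + y * y + (2 * x + 2 * y + 2) ≡⟨ rhs x y ⟩
  suc x * suc x + suc y * suc y     ∎
  where
  open ≤-Reasoning
  lhs : ∀ x y → 2 * (suc x * suc y) ≡ 2 * (x * y) + (2 * x + 2 * y + 2)
  lhs = solve-∀
  rhs : ∀ x y → x * x + y * y + (2 * x + 2 * y + 2) ≡ suc x * suc x + suc y * suc y
  rhs = solve-∀

-- Representation counts of maps into the residues and their second moments.

module Counting (p : ℕ) where

  F : List (Fin p)
  F = allFin p

  ∑F-const : (c : ℕ) → ∑ F (λ _ → c) ≡ p * c
  ∑F-const c = trans (∑-const F c) (cong (_* c) (length-tabulate (λ (i : Fin p) → i)))

  count : (X → Fin p) → List X → Fin p → ℕ
  count φ xs w = ∑ xs (λ x → ⟦ φ x ≟ w ⟧)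

  -- The number of pairs from `xs` on which `φ` collides; by `energy-count²` it is the second moment
  -- of `count φ xs`.
  energy : (X → Fin p) → List X → ℕ
  energy φ xs = ∑ xs (λ x → count φ xs (φ x))

  count≤1 : (φ : X → Fin p) {xs : List X} → Unique xs →
            (∀ {x y} → x ∈ xs → y ∈ xs → φ x ≡ φ y → x ≡ y) → ∀ w → count φ xs w ≤ 1
  count≤1 φ xs! inj w = ∑⟦⟧≤1 (λ x → φ x ≟ w) xs! λ x∈ y∈ φx φy → inj x∈ y∈ (trans φx (sym φy))

  ∑-⟦≟⟧ : ∀ v → ∑ F (λ w → ⟦ v ≟ w ⟧) ≡ 1
  ∑-⟦≟⟧ v = ≤-antisym (∑⟦⟧≤1 (v ≟_) (allFin⁺ p) λ _ _ vx vy → trans (sym vx) vy)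
    (≤-trans (≤-reflexive (sym (⟦⟧-true (v ≟ v) refl))) (f≤∑ (λ w → ⟦ v ≟ w ⟧) (∈-allFin v)))

  ∑-⟦≟⟧* : ∀ v (f : Fin p → ℕ) → ∑ F (λ w → ⟦ v ≟ w ⟧ * f w) ≡ f v
  ∑-⟦≟⟧* v f = begin
    ∑ F (λ w → ⟦ v ≟ w ⟧ * f w)  ≡⟨ ∑-cong F replace ⟩
    ∑ F (λ w → ⟦ v ≟ w ⟧ * f v)  ≡⟨ ∑-*ʳ F (f v) (λ w → ⟦ v ≟ w ⟧) ⟩
    ∑ F (λ w → ⟦ v ≟ w ⟧) * f v  ≡⟨ cong (_* f v) (∑-⟦≟⟧ v) ⟩
    1 * f v                      ≡⟨ *-identityˡ (f v) ⟩
    f v                          ∎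
    where
    open ≡-Reasoning
    replace : ∀ w → ⟦ v ≟ w ⟧ * f w ≡ ⟦ v ≟ w ⟧ * f v
    replace w with v ≟ w
    ... | yes refl = refl
    ... | no  _    = refl

  -- Groups `xs` by the value of `φ`. A constant `f` gives the first moment of `count φ xs`, and
  -- `f = count φ xs` gives the second.
  ∑-count* : (φ : X → Fin p) (xs : List X) (f : Fin p → ℕ) →
             ∑ F (λ w → count φ xs w * f w) ≡ ∑ xs (λ x → f (φ x))
  ∑-count* φ xs f = begin
    ∑ F (λ w → count φ xs w * f w)                    ≡⟨ ∑-cong F (λ w → sym (∑-*ʳ xs (f w) _)) ⟩
    ∑ F (λ w → ∑ xs (λ x → ⟦ φ x ≟ w ⟧ * f w))        ≡⟨ ∑-comm F xs _ ⟩
    ∑ xs (λ x → ∑ F (λ w → ⟦ φ x ≟ w ⟧ * f w))        ≡⟨ ∑-cong xs (λ x → ∑-⟦≟⟧* (φ x) f) ⟩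
    ∑ xs (λ x → f (φ x))                              ∎
    where open ≡-Reasoning

  ∑-count : (φ : X → Fin p) (xs : List X) → ∑ F (count φ xs) ≡ length xs
  ∑-count φ xs = begin
    ∑ F (count φ xs)                ≡⟨ ∑-cong F (λ w → sym (*-identityʳ _)) ⟩
    ∑ F (λ w → count φ xs w * 1)    ≡⟨ ∑-count* φ xs (λ _ → 1) ⟩
    ∑ xs (λ _ → 1)                  ≡⟨ ∑-const xs 1 ⟩
    length xs * 1                   ≡⟨ *-identityʳ _ ⟩
    length xs                       ∎
    where open ≡-Reasoning

  energy-count² : (φ : X → Fin p) (xs : List X) →
                  ∑ F (λ w → count φ xs w * count φ xs w) ≡ energy φ xs
  energy-count² φ xs = ∑-count* φ xs (count φ xs)

  count*count≡0 : (φ : X → Fin p) (xs : List X) (σ : Y → Fin p) (ys : List Y) →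
                  (∀ {x y} → x ∈ xs → y ∈ ys → φ x ≢ σ y) →
                  ∀ w → count φ xs w * count σ ys w ≡ 0
  count*count≡0 φ xs σ ys disj w = n≤0⇒n≡0 (begin
    count φ xs w * count σ ys w                       ≡⟨ ∑-*-∑ xs ys _ _ ⟨
    ∑ xs (λ x → ∑ ys (λ y → ⟦ φ x ≟ w ⟧ * ⟦ σ y ≟ w ⟧)) ≤⟨ ∑-mono xs (λ x∈ → ∑-mono ys (λ y∈ → vanish x∈ y∈)) ⟩
    ∑ xs (λ x → ∑ ys (λ y → 0))                       ≡⟨ ∑-cong xs (λ _ → trans (∑-const ys 0) (*-zeroʳ (length ys))) ⟩
    ∑ xs (λ x → 0)                                    ≡⟨ trans (∑-const xs 0) (*-zeroʳ (length xs)) ⟩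
    0                                                 ∎)
    where
    open ≤-Reasoning
    vanish : ∀ {x y} → x ∈ xs → y ∈ ys → ⟦ φ x ≟ w ⟧ * ⟦ σ y ≟ w ⟧ ≤ 0
    vanish {x} {y} x∈ y∈ with φ x ≟ w | σ y ≟ w
    ... | yes φx | yes σy = contradiction (trans φx (sym σy)) (disj x∈ y∈)
    ... | yes _  | no _   = z≤n
    ... | no _   | _      = z≤n

  -- Cauchy–Schwarz for count φ, which is supported off the |ys| values of σ.
  length²-bound : (φ : X → Fin p) (xs : List X) (σ : Y → Fin p) {ys : List Y} → Unique ys →
                  (∀ {y z} → y ∈ ys → z ∈ ys → σ y ≡ σ z → y ≡ z) →
                  (∀ {x y} → x ∈ xs → y ∈ ys → φ x ≢ σ y) →
                  length xs * length xs + length ys * energy φ xs ≤ p * energy φ xs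
  length²-bound {X} {Y} φ xs σ {ys} ys! inj disj = *-cancelˡ-≤ 2 (begin
    -- Every term of the doubled inequality is a double sum over residues `w` and `v`: `n * n` sums
    -- `B w * B v`, while `e * s` and `s * e` sum `B w * B w * Z v` and its mirror image. It remains
    -- to compare summands.
    2 * (n * n + s * e)                 ≡⟨ regroup n s e ⟩
    2 * (n * n) + (e * s + s * e)
      ≡⟨ cong₂ _+_ (trans (cong (2 *_) (sym BB)) (sym (∑∑-*ˡ 2 _)))
          (trans (cong₂ _+_ (sym BBZ) (sym ZBB)) (sym (∑∑-+ _ _))) ⟩
    ∑ F (λ w → ∑ F (λ v → 2 * (B w * B v))) + ∑ F (λ w → ∑ F (λ v → B w * B w * Z v + Z w * (B v * B v)))
      ≡⟨ ∑∑-+ _ _ ⟨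
    ∑ F (λ w → ∑ F (λ v → 2 * (B w * B v) + (B w * B w * Z v + Z w * (B v * B v))))
      ≤⟨ ∑-mono F (λ {w} _ → ∑-mono F (λ {v} _ →
           pointwise (B w) (Z w) (B v) (Z v) (Z≤1 w) (Z≤1 v) (BZ w) (BZ v))) ⟩
    ∑ F (λ w → ∑ F (λ v → B w * B w + B v * B v))
      ≡⟨ ∑∑-+ _ _ ⟩
    ∑ F (λ w → ∑ F (λ v → B w * B w)) + ∑ F (λ w → ∑ F (λ v → B v * B v))
      ≡⟨ cong₂ _+_ (trans (∑-cong F (λ w → ∑F-const _)) (trans (∑-*ˡ F p _) (cong (p *_) E)))
                   (trans (∑F-const _) (cong (p *_) E)) ⟩
    p * e + p * e                       ≡⟨ double p e ⟩
    2 * (p * e)                         ∎)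
    where
    open ≤-Reasoning
    n = length xs
    s = length ys
    e = energy φ xs
    B = count φ xs
    Z = count σ ys
    Z≤1 = count≤1 σ ys! inj
    BZ = count*count≡0 φ xs σ ys disj
    E = energy-count² φ xs
    regroup : ∀ n s e → 2 * (n * n + s * e) ≡ 2 * (n * n) + (e * s + s * e)
    regroup = solve-∀
    double : ∀ p e → p * e + p * e ≡ 2 * (p * e)
    double = solve-∀
    ∑∑-+ : (f g : Fin p → Fin p → ℕ) → ∑ F (λ w → ∑ F (λ v → f w v + g w v)) ≡
           ∑ F (λ w → ∑ F (f w)) + ∑ F (λ w → ∑ F (g w))
    ∑∑-+ f g = trans (∑-cong F (λ w → ∑-+ F (f w) (g w))) (∑-+ F _ _)
    ∑∑-*ˡ : ∀ c (f : Fin p → Fin p → ℕ) → ∑ F (λ w → ∑ F (λ v → c * f w v)) ≡ c * ∑ F (λ w → ∑ F (f w))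
    ∑∑-*ˡ c f = trans (∑-cong F (λ w → ∑-*ˡ F c (f w))) (∑-*ˡ F c _)
    BB : ∑ F (λ w → ∑ F (λ v → B w * B v)) ≡ n * n
    BB = trans (∑-*-∑ F F B B) (cong₂ _*_ (∑-count φ xs) (∑-count φ xs))
    BBZ : ∑ F (λ w → ∑ F (λ v → B w * B w * Z v)) ≡ e * s
    BBZ = trans (∑-*-∑ F F _ Z) (cong₂ _*_ E (∑-count σ ys))
    ZBB : ∑ F (λ w → ∑ F (λ v → Z w * (B v * B v))) ≡ s * e
    ZBB = trans (∑-*-∑ F F Z _) (cong₂ _*_ (∑-count σ ys) E)
    -- If `z` and `y` vanish, this is AM-GM. If one of them is 1, the matching `b` or `c` is 0, the
    -- mixed product disappears, and the freed square absorbs the extra terms.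
    pointwise : ∀ b z c y → z ≤ 1 → y ≤ 1 → b * z ≡ 0 → c * y ≡ 0 →
                2 * (b * c) + (b * b * y + z * (c * c)) ≤ b * b + c * c
    pointwise b 0 c 0 _ _ _ _ rewrite *-zeroʳ (b * b) | +-identityʳ (2 * (b * c)) = 2xy≤x²+y² b c
    pointwise b 0 zero 1 _ _ _ _ rewrite *-zeroʳ b = ≤-reflexive (cong (_+ 0) (*-identityʳ (b * b)))
    pointwise zero 1 c y _ _ _ _ = ≤-reflexive (+-identityʳ (c * c))
    pointwise b 0 (suc c) 1 _ _ _ ()
    pointwise (suc b) 1 c y _ _ () _
    pointwise b (suc (suc _)) c y (s≤s ()) _ _ _
    pointwise b 0 c (suc (suc _)) _ (s≤s ()) _ _

  -- Grouping the left side by the value of `σ` gives each `f v` a weight of at most 1.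
  ∑-injective : (σ : Fin p → Fin p) → (∀ {x y} → σ x ≡ σ y → x ≡ y) →
                (f : Fin p → ℕ) → ∑ F (λ w → f (σ w)) ≤ ∑ F f
  ∑-injective σ inj f = begin
    ∑ F (λ w → f (σ w))             ≡⟨ ∑-count* σ F f ⟨
    ∑ F (λ v → count σ F v * f v)   ≤⟨ ∑-mono F (λ {v} _ → *-monoˡ-≤ (f v) (count≤1 σ (allFin⁺ p) (λ _ _ → inj) v)) ⟩
    ∑ F (λ v → 1 * f v)             ≡⟨ ∑-cong F (λ v → *-identityˡ (f v)) ⟩
    ∑ F f                           ∎
    where open ≤-Reasoning

  -- By AM-GM, the correlation of `count φ xs` with its rearrangement under `σ` is at most the mean
  -- of their second moments, and rearranging does not increase the second moment.
  twisted≤energy : (φ : X → Fin p) (xs : List X) (σ : Fin p → Fin p) → (∀ {x y} → σ x ≡ σ y → x ≡ y) →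
                   ∑ xs (λ x → count φ xs (σ (φ x))) ≤ energy φ xs
  twisted≤energy φ xs σ inj = *-cancelˡ-≤ 2 (begin
    2 * ∑ xs (λ x → B (σ (φ x)))                ≡⟨ cong (2 *_) (∑-count* φ xs (λ w → B (σ w))) ⟨
    2 * ∑ F (λ w → B w * B (σ w))               ≡⟨ ∑-*ˡ F 2 _ ⟨
    ∑ F (λ w → 2 * (B w * B (σ w)))             ≤⟨ ∑-mono F (λ {w} _ → 2xy≤x²+y² (B w) (B (σ w))) ⟩
    ∑ F (λ w → B w * B w + B (σ w) * B (σ w))   ≡⟨ ∑-+ F _ _ ⟩
    ∑ F (λ w → B w * B w) + ∑ F (λ w → B (σ w) * B (σ w))
                                                ≤⟨ +-monoʳ-≤ _ (∑-injective σ inj (λ w → B w * B w)) ⟩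
    ∑ F (λ w → B w * B w) + ∑ F (λ w → B w * B w)
                                                ≡⟨ cong₂ _+_ E (trans E (sym (+-identityʳ e))) ⟩
    2 * e                                       ∎)
    where
    open ≤-Reasoning
    B = count φ xs
    e = energy φ xs
    E = energy-count² φ xs

  -- After exchanging the sums, each diagonal pair collides for at most all `p` parameters, and by
  -- `separate` each other pair for at most one.
  ∑-energy : (_≟X_ : DecidableEquality X) (φ : Fin p → X → Fin p) {xs : List X} → Unique xs →
             (∀ {u v x y} → u ≢ v → φ u x ≡ φ u y → φ v x ≡ φ v y → x ≡ y) →
             ∑ F (λ u → energy (φ u) xs) ≤ p * length xs + length xs * length xs
  ∑-energy _≟X_ φ {xs} xs! separate = begin
    ∑ F (λ u → ∑ xs (λ x → ∑ xs (λ y → ⟦ φ u y ≟ φ u x ⟧)))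
      ≡⟨ ∑-comm F xs _ ⟩
    ∑ xs (λ x → ∑ F (λ u → ∑ xs (λ y → ⟦ φ u y ≟ φ u x ⟧)))
      ≡⟨ ∑-cong xs (λ x → ∑-comm F xs _) ⟩
    ∑ xs (λ x → ∑ xs (λ y → ∑ F (λ u → ⟦ φ u y ≟ φ u x ⟧)))
      ≤⟨ ∑-mono xs (λ {x} _ → ∑-mono xs (λ {y} _ → pair y x)) ⟩
    ∑ xs (λ x → ∑ xs (λ y → p * ⟦ y ≟X x ⟧ + 1))
      ≡⟨ ∑-cong xs (λ x → trans (∑-+ xs _ _) (cong₂ _+_ (∑-*ˡ xs p _) (trans (∑-const xs 1) (*-identityʳ n)))) ⟩
    ∑ xs (λ x → p * ∑ xs (λ y → ⟦ y ≟X x ⟧) + n)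
      ≤⟨ ∑-mono xs (λ {x} _ → +-monoˡ-≤ n (*-monoʳ-≤ p (∑⟦⟧≤1 (_≟X x) xs! (λ _ _ yx zx → trans yx (sym zx))))) ⟩
    ∑ xs (λ x → p * 1 + n)
      ≡⟨ ∑-const xs _ ⟩
    n * (p * 1 + n)
      ≡⟨ expand n p ⟩
    p * n + n * n ∎
    where
    open ≤-Reasoning
    n = length xs
    expand : ∀ n p → n * (p * 1 + n) ≡ p * n + n * n
    expand = solve-∀
    pair : ∀ y x → ∑ F (λ u → ⟦ φ u y ≟ φ u x ⟧) ≤ p * ⟦ y ≟X x ⟧ + 1
    pair y x with y ≟X x
    ... | yes _  = ≤-trans (∑-mono F (λ {u} _ → ⟦⟧≤1 (φ u y ≟ φ u x)))
                           (≤-trans (≤-reflexive (∑F-const 1)) (m≤m+n (p * 1) 1))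
    ... | no y≢x = ≤-trans (∑⟦⟧≤1 (λ u → φ u y ≟ φ u x) (allFin⁺ p) same) (m≤n+m 1 (p * 0))
      where
      same : ∀ {u v} → u ∈ F → v ∈ F → φ u y ≡ φ u x → φ v y ≡ φ v x → u ≡ v
      same {u} {v} _ _ eu ev with u ≟ v
      ... | yes u≡v = u≡v
      ... | no  u≢v = contradiction (separate u≢v eu ev) y≢x

  -- In p² ∑ e every residue accounts for at least `p * a`. A residue hit by `r` accounts for
  -- `n * a` more: scale its special bound by `p` and use `n * a ≤ n * (p * e u)`. The bound on ∑ e
  -- leaves only p³ b above the common baseline p² a, which limits the number of hits.
  length-bound : (e : Fin p → ℕ) (a b n : ℕ) {ks : List X} (r : X → Fin p) → Unique ks →
                 (∀ {j k} → j ∈ ks → k ∈ ks → r j ≡ r k → j ≡ k) →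
                 (∀ u → a ≤ p * e u) → ∑ F e ≤ p * b + a →
                 (∀ {k} → k ∈ ks → a + n * e (r k) ≤ p * e (r k)) →
                 n * a * length ks ≤ p * p * p * b
  length-bound e a b n {ks} r ks! inj every total special = +-cancelˡ-≤ (p * (p * a)) _ _ (begin
    p * (p * a) + n * a * length ks           ≡⟨ cong₂ _+_ (sym (∑F-const (p * a))) (cong (n * a *_) (sym (∑-count r ks))) ⟩
    ∑ F (λ _ → p * a) + n * a * ∑ F C         ≡⟨ cong (_ +_) (sym (∑-*ˡ F (n * a) C)) ⟩
    ∑ F (λ _ → p * a) + ∑ F (λ u → n * a * C u) ≡⟨ ∑-+ F _ _ ⟨
    ∑ F (λ u → p * a + n * a * C u)           ≤⟨ ∑-mono F (λ {u} _ → each u) ⟩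
    ∑ F (λ u → p * p * e u)                   ≡⟨ ∑-*ˡ F (p * p) e ⟩
    p * p * ∑ F e                             ≤⟨ *-monoʳ-≤ (p * p) total ⟩
    p * p * (p * b + a)                       ≡⟨ expand p b a ⟩
    p * (p * a) + p * p * p * b               ∎)
    where
    open ≤-Reasoning
    C = count r ks
    expand : ∀ p b a → p * p * (p * b + a) ≡ p * (p * a) + p * p * p * b
    expand = solve-∀
    factor : ∀ p a n e → p * a + n * (p * e) ≡ p * (a + n * e)
    factor = solve-∀
    each : ∀ u → p * a + n * a * C u ≤ p * p * e u
    each u with any? (λ k → r k ≟ u) ks
    ... | yes has with find has
    ... | k , k∈ , refl = begin
      p * a + n * a * C u             ≤⟨ +-monoʳ-≤ (p * a) (*-monoʳ-≤ (n * a) (count≤1 r ks! inj u)) ⟩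
      p * a + n * a * 1               ≡⟨ cong (p * a +_) (*-identityʳ (n * a)) ⟩
      p * a + n * a                   ≤⟨ +-monoʳ-≤ (p * a) (*-monoʳ-≤ n (every u)) ⟩
      p * a + n * (p * e u)           ≡⟨ factor p a n (e u) ⟩
      p * (a + n * e u)               ≤⟨ *-monoʳ-≤ p (special k∈) ⟩
      p * (p * e u)                   ≡⟨ *-assoc p p (e u) ⟨
      p * p * e u                     ∎
    each u | no hasn't = begin
      p * a + n * a * C u             ≤⟨ +-monoʳ-≤ (p * a) (*-monoʳ-≤ (n * a) C≤0) ⟩
      p * a + n * a * 0               ≡⟨ trans (cong (p * a +_) (*-zeroʳ (n * a))) (+-identityʳ (p * a)) ⟩
      p * a                           ≤⟨ *-monoʳ-≤ p (every u) ⟩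
      p * (p * e u)                   ≡⟨ *-assoc p p (e u) ⟨
      p * p * e u                     ∎
      where
      C≤0 : C u ≤ 0
      C≤0 = ≤-trans (∑-mono ks (λ {k} k∈ → ⟦⟧≤ {n = 0} (r k ≟ u) (λ rk → contradiction (lose k∈ rk) hasn't)))
                    (≤-reflexive (trans (∑-const ks 0) (*-zeroʳ (length ks))))

open import Data.Integer as ℤ using (ℤ; +_; 0ℤ; 1ℤ; -1ℤ)
import Data.Integer.Properties as ℤ
import Data.Integer.Tactic.RingSolver as ℤ-Solver

-- Subsets as lists, and counting quadruples.

elems-unique : ∀ {n} (A : Subset n) → Unique (elems A)
elems-unique {n} A = filter⁺ (λ x → x ∈? A) (allFin⁺ n)

∈-elems⁻ : ∀ {n} (A : Subset n) {x} → x ∈ elems A → x ∈ₛ A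
∈-elems⁻ {n} A x∈ = proj₂ (∈-filter⁻ (λ x → x ∈? A) {xs = allFin n} x∈)

∑-allFin-suc : ∀ {n} (f : Fin (suc n) → ℕ) → ∑ (allFin (suc n)) f ≡ f zero + ∑ (allFin n) (f ∘ suc)
∑-allFin-suc {n} f = cong (λ ys → f zero + sum ys)
  (trans (map-tabulate suc f) (sym (map-tabulate (λ i → i) (f ∘ suc))))

length-elems : ∀ {n} (A : Subset n) → length (elems A) ≡ ∣ A ∣
length-elems {n} A = trans (length-filter-∑ (_∈? A) (allFin n)) (∑∈ A)
  where
  ∑∈ : ∀ {n} (A : Subset n) → ∑ (allFin n) (λ x → ⟦ x ∈? A ⟧) ≡ ∣ A ∣
  tail : ∀ {n} s (A : Subset n) → ∑ (allFin n) (λ x → ⟦ suc x ∈? (s ∷ A) ⟧) ≡ ∣ A ∣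
  tail {n} s A = trans (∑-cong (allFin n) λ x →
    ≤-antisym (⟦⟧-mono (suc x ∈? (s ∷ A)) (x ∈? A) drop-there) (⟦⟧-mono (x ∈? A) (suc x ∈? (s ∷ A)) there)) (∑∈ A)
  ∑∈ []            = refl
  ∑∈ (inside  ∷ A) = trans (∑-allFin-suc (λ x → ⟦ x ∈? (inside ∷ A) ⟧))
    (cong₂ _+_ (⟦⟧-true (zero ∈? (inside ∷ A)) here) (tail inside A))
  ∑∈ (outside ∷ A) = trans (∑-allFin-suc (λ x → ⟦ x ∈? (outside ∷ A) ⟧))
    (cong₂ _+_ (⟦⟧-false (zero ∈? (outside ∷ A)) λ ()) (tail outside A))

-- Has the shape of the body of `Eplus`, so that the additive energy becomes a fourfold sum of
-- indicators.
length-filter-quadruples :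
  {X : Set} {R : X × X × X × X → Set} (R? : Decidable R) (xs : List X) →
  length (filter R? (concatMap (λ x → concatMap (λ y → concatMap (λ z → map (λ w → x , y , z , w) xs) xs) xs) xs)) ≡
  ∑ xs (λ x → ∑ xs (λ y → ∑ xs (λ z → ∑ xs (λ w → ⟦ R? (x , y , z , w) ⟧))))
length-filter-quadruples R? xs = trans (length-filter-∑ R? (concatMap _ xs)) (trans (∑-concatMap _ xs f)
  (∑-cong xs λ x → trans (∑-concatMap _ xs f) (∑-cong xs λ y →
   trans (∑-concatMap _ xs f) (∑-cong xs λ z → ∑-map (λ w → x , y , z , w) xs f))))
  where f = λ m → ⟦ R? m ⟧

-- Energies of the forms x + uy on a fixed set.

module Energies (q : ℕ) (pr : Prime (suc q)) (A : Subset (suc q)) where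
  open Modular q pr
  open Counting p

  L : List (Fin p)
  L = elems A

  N : ℕ
  N = length L

  M : List (Fin p × Fin p)
  M = cartesianProduct L L

  L! : Unique L
  L! = elems-unique A

  length-M : length M ≡ N * N
  length-M = begin
    length M               ≡⟨ *-identityʳ _ ⟨
    length M * 1           ≡⟨ ∑-const M 1 ⟨
    ∑ M (λ _ → 1)          ≡⟨ ∑-cartesianProduct L L (λ _ → 1) ⟩
    ∑ L (λ _ → ∑ L (λ _ → 1)) ≡⟨ ∑-cong L (λ _ → trans (∑-const L 1) (*-identityʳ N)) ⟩
    ∑ L (λ _ → N)          ≡⟨ ∑-const L N ⟩
    N * N                  ∎
    where open ≡-Reasoning

  ∑M : (f : Fin p → Fin p → Fin p → Fin p → ℕ) → ∑ M (λ { (x , y) → ∑ M (λ { (z , w) → f x y z w }) }) ≡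
       ∑ L (λ x → ∑ L (λ y → ∑ L (λ z → ∑ L (f x y z))))
  ∑M f = trans (∑-cartesianProduct L L _) (∑-cong L λ x → ∑-cong L λ y → ∑-cartesianProduct L L _)

  φ : Fin p → Fin p × Fin p → Fin p
  φ u (x , y) = res (ι x ℤ.+ ι u ℤ.* ι y)

  ψ : Fin p × Fin p → Fin p
  ψ (x , y) = res (ι x ℤ.- ι y)

  E : Fin p → ℕ
  E u = energy (φ u) M

  -- Taking the list of missed values empty in `length²-bound` leaves plain Cauchy-Schwarz.
  N⁴≤pE : ∀ u → N * N * (N * N) ≤ p * E u
  N⁴≤pE u = subst (λ m → m * m ≤ p * E u) length-M
    (≤-trans (m≤m+n _ 0) (length²-bound (φ u) M (λ x → x) {[]} [] (λ ()) (λ _ ())))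

  ∑E≤ : ∑ F E ≤ p * (N * N) + N * N * (N * N)
  ∑E≤ = subst (λ m → ∑ F E ≤ p * m + m * m) length-M
    (∑-energy (≡-dec _≟_ _≟_) φ (cartesianProduct⁺ L! L!) separate)
    where
    -- Subtracting the two collisions gives (u - v)(y - y′) ≋ 0. Hence the second coordinates agree,
    -- and then so do the first.
    separate : ∀ {u v m n} → u ≢ v → φ u m ≡ φ u n → φ v m ≡ φ v n → m ≡ n
    separate {u} {v} {x , y} {x′ , y′} u≢v eu ev = cong₂ _,_ (ι-injective x≋x′) (ι-injective y≋y′)
      where
      eqᵤ = res-injective {ι x ℤ.+ ι u ℤ.* ι y} {ι x′ ℤ.+ ι u ℤ.* ι y′} eu
      eqᵥ = res-injective {ι x ℤ.+ ι v ℤ.* ι y} {ι x′ ℤ.+ ι v ℤ.* ι y′} ev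
      u-v≉0 : ι u ℤ.- ι v ≉ 0ℤ
      u-v≉0 u-v≋0 = u≢v (ι-injective (combine₁ 1ℤ u-v≋0 (eq (ι u) (ι v))))
        where
        eq : ∀ u v → u ℤ.- v ≡ 1ℤ ℤ.* ((u ℤ.- v) ℤ.- 0ℤ)
        eq = ℤ-Solver.solve-∀
      y≋y′ : ι y ≋ ι y′
      y≋y′ = *-cancelˡ u-v≉0 (combine₂ 1ℤ -1ℤ eqᵤ eqᵥ (eq (ι u) (ι v) (ι x) (ι y) (ι x′) (ι y′)))
        where
        eq : ∀ u v x y x′ y′ → (u ℤ.- v) ℤ.* y ℤ.- (u ℤ.- v) ℤ.* y′ ≡
             1ℤ ℤ.* ((x ℤ.+ u ℤ.* y) ℤ.- (x′ ℤ.+ u ℤ.* y′)) ℤ.+ -1ℤ ℤ.* ((x ℤ.+ v ℤ.* y) ℤ.- (x′ ℤ.+ v ℤ.* y′))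
        eq = ℤ-Solver.solve-∀
      x≋x′ : ι x ≋ ι x′
      x≋x′ = combine₂ 1ℤ (ℤ.- ι u) eqᵤ y≋y′ (eq (ι u) (ι x) (ι y) (ι x′) (ι y′))
        where
        eq : ∀ u x y x′ y′ → x ℤ.- x′ ≡
             1ℤ ℤ.* ((x ℤ.+ u ℤ.* y) ℤ.- (x′ ℤ.+ u ℤ.* y′)) ℤ.+ (ℤ.- u) ℤ.* (y ℤ.- y′)
        eq = ℤ-Solver.solve-∀

  -- A collision x′ + uy′ = x + uy reads x′ - x = -u(y′ - y). So `E u` is at most a correlation of
  -- the difference counts with their dilate by -u, a bijective twist because u is nonzero.
  E≤energy-ψ : ∀ {u} → ι u ≉ 0ℤ → E u ≤ energy ψ M
  E≤energy-ψ {u} u≉0 = begin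
    E u
      ≡⟨ ∑M (λ x y x′ y′ → ⟦ φ u (x′ , y′) ≟ φ u (x , y) ⟧) ⟩
    ∑ L (λ x → ∑ L (λ y → ∑ L (λ x′ → ∑ L (λ y′ → ⟦ φ u (x′ , y′) ≟ φ u (x , y) ⟧))))
      ≤⟨ (∑-mono L λ {x} _ → ∑-mono L λ {y} _ → ∑-mono L λ {x′} _ → ∑-mono L λ {y′} _ →
           ⟦⟧-mono (φ u (x′ , y′) ≟ φ u (x , y)) (ψ (x′ , x) ≟ σ (ψ (y′ , y))) (regroup x y x′ y′)) ⟩
    ∑ L (λ x → ∑ L (λ y → ∑ L (λ x′ → ∑ L (λ y′ → h y′ y x′ x))))
      -- The exchanges bring the variables into the order y′, y, x′, x, so that the outer two and
      -- the inner two each form one element of `M`.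
      ≡⟨ ∑-comm L L _ ⟩
    ∑ L (λ y → ∑ L (λ x → ∑ L (λ x′ → ∑ L (λ y′ → h y′ y x′ x))))
      ≡⟨ ∑-cong L (λ y → ∑-cong L (λ x → ∑-comm L L _)) ⟩
    ∑ L (λ y → ∑ L (λ x → ∑ L (λ y′ → ∑ L (λ x′ → h y′ y x′ x))))
      ≡⟨ ∑-cong L (λ y → ∑-comm L L _) ⟩
    ∑ L (λ y → ∑ L (λ y′ → ∑ L (λ x → ∑ L (λ x′ → h y′ y x′ x))))
      ≡⟨ ∑-comm L L _ ⟩
    ∑ L (λ y′ → ∑ L (λ y → ∑ L (λ x → ∑ L (λ x′ → h y′ y x′ x))))
      ≡⟨ ∑-cong L (λ y′ → ∑-cong L (λ y → ∑-comm L L _)) ⟩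
    ∑ L (λ y′ → ∑ L (λ y → ∑ L (λ x′ → ∑ L (λ x → h y′ y x′ x))))
      ≡⟨ ∑M h ⟨
    ∑ M (λ m → count ψ M (σ (ψ m)))
      ≤⟨ twisted≤energy ψ M σ σ-injective ⟩
    energy ψ M ∎
    where
    open ≤-Reasoning
    σ : Fin p → Fin p
    σ w = res (ℤ.- ι u ℤ.* ι w)
    h : Fin p → Fin p → Fin p → Fin p → ℕ
    h y′ y x′ x = ⟦ ψ (x′ , x) ≟ σ (ψ (y′ , y)) ⟧
    -u≉0 : ℤ.- ι u ≉ 0ℤ
    -u≉0 -u≋0 = u≉0 (combine₁ -1ℤ -u≋0 (eq (ι u)))
      where
      eq : ∀ u → u ℤ.- 0ℤ ≡ -1ℤ ℤ.* ((ℤ.- u) ℤ.- 0ℤ)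
      eq = ℤ-Solver.solve-∀
    σ-injective : ∀ {x y} → σ x ≡ σ y → x ≡ y
    σ-injective {x} {y} eq = ι-injective (*-cancelˡ -u≉0 (res-injective {ℤ.- ι u ℤ.* ι x} {ℤ.- ι u ℤ.* ι y} eq))
    regroup : ∀ x y x′ y′ → φ u (x′ , y′) ≡ φ u (x , y) → ψ (x′ , x) ≡ σ (ψ (y′ , y))
    regroup x y x′ y′ e = res-cong {ι x′ ℤ.- ι x} {ℤ.- ι u ℤ.* ι (ψ (y′ , y))} (combine₂ 1ℤ (ι u)
      (res-injective {ι x′ ℤ.+ ι u ℤ.* ι y′} {ι x ℤ.+ ι u ℤ.* ι y} e) (ι-res (ι y′ ℤ.- ι y))
      (eq (ι u) (ι x) (ι y) (ι x′) (ι y′) (ι (res (ι y′ ℤ.- ι y)))))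
      where
      eq : ∀ u x y x′ y′ w → (x′ ℤ.- x) ℤ.- (ℤ.- u) ℤ.* w ≡
           1ℤ ℤ.* ((x′ ℤ.+ u ℤ.* y′) ℤ.- (x ℤ.+ u ℤ.* y)) ℤ.+ u ℤ.* (w ℤ.- (y′ ℤ.- y))
      eq = ℤ-Solver.solve-∀

  -- Moving the negative terms across turns z - w = x - y into x + w = y + z.
  energy-ψ≤Eplus : energy ψ M ≤ Eplus A
  energy-ψ≤Eplus = begin
    energy ψ M
      ≡⟨ ∑M (λ x y z w → ⟦ ψ (z , w) ≟ ψ (x , y) ⟧) ⟩
    ∑ L (λ x → ∑ L (λ y → ∑ L (λ z → ∑ L (λ w → ⟦ ψ (z , w) ≟ ψ (x , y) ⟧))))
      ≤⟨ (∑-mono L λ {x} _ → ∑-mono L λ {y} _ → ∑-mono L λ {z} _ → ∑-mono L λ {w} _ →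
           ⟦⟧-mono (ψ (z , w) ≟ ψ (x , y)) (md p (toℕ x + toℕ w) ℕ.≟ md p (toℕ y + toℕ z)) (regroup x y z w)) ⟩
    ∑ L (λ x → ∑ L (λ y → ∑ L (λ z → ∑ L (λ w → h x w y z))))
      ≡⟨ ∑-cong L (λ x → ∑-cong L (λ y → ∑-comm L L _)) ⟩
    ∑ L (λ x → ∑ L (λ y → ∑ L (λ w → ∑ L (λ z → h x w y z))))
      ≡⟨ ∑-cong L (λ x → ∑-comm L L _) ⟩
    ∑ L (λ x → ∑ L (λ w → ∑ L (λ y → ∑ L (λ z → h x w y z))))
      ≡⟨ quadruples ⟨
    Eplus A ∎
    where
    open ≤-Reasoning
    h : Fin p → Fin p → Fin p → Fin p → ℕ
    h x w y z = ⟦ md p (toℕ x + toℕ w) ℕ.≟ md p (toℕ y + toℕ z) ⟧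
    quadruples : Eplus A ≡ ∑ L (λ x → ∑ L (λ w → ∑ L (λ y → ∑ L (λ z → h x w y z))))
    quadruples = length-filter-quadruples _ L
    regroup : ∀ x y z w → ψ (z , w) ≡ ψ (x , y) → md p (toℕ x + toℕ w) ≡ md p (toℕ y + toℕ z)
    regroup x y z w e = +-injective-< (md<p (toℕ x + toℕ w)) (md<p (toℕ y + toℕ z))
      (≋-trans (+md (toℕ x + toℕ w)) (≋-trans
        (combine₁ -1ℤ (res-injective {ι z ℤ.- ι w} {ι x ℤ.- ι y} e)
          (trans (cong₂ ℤ._-_ (ℤ.pos-+ (toℕ x) (toℕ w)) (ℤ.pos-+ (toℕ y) (toℕ z))) (eq (ι x) (ι y) (ι z) (ι w))))
        (≋-sym (+md (toℕ y + toℕ z)))))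
      where
      eq : ∀ x y z w → (x ℤ.+ w) ℤ.- (y ℤ.+ z) ≡ -1ℤ ℤ.* ((z ℤ.- w) ℤ.- (x ℤ.- y))
      eq = ℤ-Solver.solve-∀

  -- Avoided linear forms and the ratios of their coefficients.

  AvoidsForm : ℤ → ℤ → ℤ → ℤ → Set
  AvoidsForm α β γ δ = ∀ {x y z} → x ∈ L → y ∈ L → z ∈ L → α ℤ.* ι x ℤ.+ β ℤ.* ι y ℤ.+ γ ℤ.* ι z ≉ δ

  avoids-swap₁₂ : ∀ {α β γ δ} → AvoidsForm α β γ δ → AvoidsForm β α γ δ
  avoids-swap₁₂ {α} {β} {γ} {δ} av {x} {y} {z} x∈ y∈ z∈ e =
    av y∈ x∈ z∈ (≋-trans (≋-reflexive (eq α β (ι x) (ι y) (γ ℤ.* ι z))) e)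
    where
    eq : ∀ α β x y w → α ℤ.* y ℤ.+ β ℤ.* x ℤ.+ w ≡ β ℤ.* x ℤ.+ α ℤ.* y ℤ.+ w
    eq = ℤ-Solver.solve-∀

  avoids-swap₂₃ : ∀ {α β γ δ} → AvoidsForm α β γ δ → AvoidsForm α γ β δ
  avoids-swap₂₃ {α} {β} {γ} {δ} av {x} {y} {z} x∈ y∈ z∈ e =
    av x∈ z∈ y∈ (≋-trans (≋-reflexive (eq (α ℤ.* ι x) β γ (ι y) (ι z))) e)
    where
    eq : ∀ w β γ y z → w ℤ.+ β ℤ.* z ℤ.+ γ ℤ.* y ≡ w ℤ.+ γ ℤ.* y ℤ.+ β ℤ.* z
    eq = ℤ-Solver.solve-∀

  -- Witnesses that `u` is the y-coefficient of an avoided equation normalised to x-coefficient 1,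
  -- the form on which the energy estimates operate.
  record Ratio (u : Fin p) : Set where
    field
      u≉0    : ι u ≉ 0ℤ
      v e    : ℤ
      v≉0    : v ≉ 0ℤ
      avoids : AvoidsForm 1ℤ (ι u) v e

  -- The map z ↦ e - vz is injective on `L` since v is nonzero, and avoidance says that x + uy never
  -- takes its values there. These are the `N` missed residues for `length²-bound`.
  E-excess : ∀ {u} → Ratio u → N * N * (N * N) + N * E u ≤ p * E u
  E-excess {u} ρ = subst (λ m → m * m + N * E u ≤ p * E u) length-M
    (length²-bound (φ u) M σ L! (λ {y} {z} _ _ → σ-injective y z) disjoint)
    where
    open Ratio ρ
    σ : Fin p → Fin p
    σ z = res (e ℤ.- v ℤ.* ι z)
    σ-injective : ∀ y z → σ y ≡ σ z → y ≡ z
    σ-injective y z σy≡σz = ι-injective (*-cancelˡ v≉0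
      (combine₁ -1ℤ (res-injective {e ℤ.- v ℤ.* ι y} {e ℤ.- v ℤ.* ι z} σy≡σz) (eq e v (ι y) (ι z))))
      where
      eq : ∀ e v y z → v ℤ.* y ℤ.- v ℤ.* z ≡ -1ℤ ℤ.* ((e ℤ.- v ℤ.* y) ℤ.- (e ℤ.- v ℤ.* z))
      eq = ℤ-Solver.solve-∀
    disjoint : ∀ {m z} → m ∈ M → z ∈ L → φ u m ≢ σ z
    disjoint {x , y} {z} m∈ z∈ φ≡σ with ∈-cartesianProduct⁻ L L m∈
    ... | x∈ , y∈ = avoids x∈ y∈ z∈
      (combine₁ 1ℤ (res-injective {ι x ℤ.+ ι u ℤ.* ι y} {e ℤ.- v ℤ.* ι z} φ≡σ) (eq e v (ι u) (ι x) (ι y) (ι z)))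
      where
      eq : ∀ e v u x y z → (1ℤ ℤ.* x ℤ.+ u ℤ.* y ℤ.+ v ℤ.* z) ℤ.- e ≡
           1ℤ ℤ.* ((x ℤ.+ u ℤ.* y) ℤ.- (e ℤ.- v ℤ.* z))
      eq = ℤ-Solver.solve-∀

  -- `length-bound` with `a` = N⁴ and `b` = N² bounds N⁵ times the number of ratios by p³ N², and N²
  -- cancels.
  ratios-bound : ∀ {X : Set} {ks : List X} (r : X → Fin p) → Unique ks →
                 (∀ {j k} → j ∈ ks → k ∈ ks → r j ≡ r k → j ≡ k) → (∀ k → Ratio (r k)) →
                 length ks * N ^ 3 ≤ p ^ 3
  ratios-bound {ks = ks} r ks! inj ratio = cancel N (begin
    N * (N * N * (N * N)) * length ks ≤⟨ length-bound E (N * N * (N * N)) (N * N) N r ks! inj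
                                           N⁴≤pE ∑E≤ (λ {k} _ → E-excess (ratio k)) ⟩
    p * p * p * (N * N)               ≡⟨ cong (_* (N * N)) (cube p) ⟩
    p ^ 3 * (N * N)                   ∎)
    where
    open ≤-Reasoning
    cube : ∀ p → p * p * p ≡ p * (p * (p * 1))
    cube = solve-∀
    fifth : ∀ k n → k * (n * (n * (n * 1))) * (n * n) ≡ n * (n * n * (n * n)) * k
    fifth = solve-∀
    cancel : ∀ n {k c} → n * (n * n * (n * n)) * k ≤ c * (n * n) → k * n ^ 3 ≤ c
    -- For an empty set there is nothing to cancel, but the left side is already 0.
    cancel zero    {k} _ = ≤-trans (≤-reflexive (*-zeroʳ k)) z≤n
    cancel (suc m) {k} h = *-cancelʳ-≤ _ _ (suc m * suc m) (≤-trans (≤-reflexive (fifth k (suc m))) h)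

  -- `E-excess` and E(u) ≤ E⁺ give N E(u) ≤ p E⁺ - N⁴. The lower bound N⁴ ≤ p E(u) then eliminates
  -- E(u).
  Eplus-excess : ∀ {u} → Ratio u → N ^ 5 ≤ p * (p * Eplus A ∸ N ^ 4)
  Eplus-excess {u} ρ = begin
    N ^ 5                             ≡⟨ fifth N ⟩
    N * (N * N * (N * N))             ≤⟨ *-monoʳ-≤ N (N⁴≤pE u) ⟩
    N * (p * E u)                     ≡⟨ swap N p (E u) ⟩
    p * (N * E u)                     ≤⟨ *-monoʳ-≤ p NE≤ ⟩
    p * (p * Eplus A ∸ N ^ 4)         ∎
    where
    open ≤-Reasoning
    open Ratio ρ
    fifth : ∀ N → N * (N * (N * (N * (N * 1)))) ≡ N * (N * N * (N * N))
    fifth = solve-∀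
    fourth : ∀ N → N * N * (N * N) ≡ N * (N * (N * (N * 1)))
    fourth = solve-∀
    swap : ∀ N p e → N * (p * e) ≡ p * (N * e)
    swap = solve-∀
    NE≤ : N * E u ≤ p * Eplus A ∸ N ^ 4
    NE≤ = m+n≤o⇒n≤o∸m (N ^ 4) (≤-trans
      (≤-trans (≤-reflexive (cong (λ m → m + N * E u) (sym (fourth N)))) (E-excess ρ))
      (*-monoʳ-≤ p (≤-trans (E≤energy-ψ u≉0) energy-ψ≤Eplus)))
      where
      m+n≤o⇒n≤o∸m : ∀ m {n o} → m + n ≤ o → n ≤ o ∸ m
      m+n≤o⇒n≤o∸m m {n} {o} h = m+n≤o⇒m≤o∸n n (subst (_≤ o) (+-comm m n) h)

  -- Divides the equation by α. The quotient `u` enters only through α u ≋ β, so each `div` value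
  -- can be supplied together with its defining congruence.
  avoids⇒ratio : ∀ {α β γ δ} (u : Fin p) → AvoidsForm α β γ δ → α ≉ 0ℤ → β ≉ 0ℤ → γ ≉ 0ℤ →
                 α ℤ.* ι u ≋ β → Ratio u
  avoids⇒ratio {α} {β} {γ} {δ} u av α≉0 β≉0 γ≉0 αu≋β with inverse α≉0
  ... | α′ , αα′≋1 = record
    { u≉0    = λ u≋0 → β≉0 (≋-trans (≋-sym αu≋β)
                 (≋-trans (*-congˡ α u≋0) (≋-reflexive (ℤ.*-zeroʳ α))))
    ; v      = α′ ℤ.* γ
    ; e      = α′ ℤ.* δ
    ; v≉0    = *-≉0 α′≉0 γ≉0
    ; avoids = λ {x} {y} {z} x∈ y∈ z∈ e → av x∈ y∈ z∈
        -- Multiplying the normalised equation by α restores the original one up to multiples of α u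
        -- - β and α α′ - 1.
        (combine₃ α (ℤ.- ι y) (ℤ.- (γ ℤ.* ι z ℤ.- δ)) e αu≋β αα′≋1
          (clear α β γ δ (ι u) α′ (ι x) (ι y) (ι z)))
    }
    where
    α′≉0 : α′ ≉ 0ℤ
    α′≉0 α′≋0 = α≉0 (combine₂ (α ℤ.* α) (ℤ.- α) α′≋0 αα′≋1 (eq α α′))
      where
      eq : ∀ α α′ → α ℤ.- 0ℤ ≡ α ℤ.* α ℤ.* (α′ ℤ.- 0ℤ) ℤ.+ (ℤ.- α) ℤ.* (α ℤ.* α′ ℤ.- 1ℤ)
      eq = ℤ-Solver.solve-∀
    clear : ∀ α β γ δ u α′ x y z → α ℤ.* x ℤ.+ β ℤ.* y ℤ.+ γ ℤ.* z ℤ.- δ ≡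
            α ℤ.* ((1ℤ ℤ.* x ℤ.+ u ℤ.* y ℤ.+ α′ ℤ.* γ ℤ.* z) ℤ.- α′ ℤ.* δ) ℤ.+
            (ℤ.- y) ℤ.* (α ℤ.* u ℤ.- β) ℤ.+ (ℤ.- (γ ℤ.* z ℤ.- δ)) ℤ.* (α ℤ.* α′ ℤ.- 1ℤ)
    clear = ℤ-Solver.solve-∀

  -- For a triple scaled to (1, u, v), the three invariants u, v and u / v are
  -- each the quotient of two coefficients of the equation, so each of them
  -- becomes the y-coefficient after reordering the variables and rescaling.
  invariant : Fin 3 → ℕ → ℕ → ℕ
  invariant zero             u v = u
  invariant (suc zero)       u v = v
  invariant (suc (suc zero)) u v = div p u v

  invariant<p : ∀ o {u v} → u ℕ.< p → v ℕ.< p → invariant o u v ℕ.< p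
  invariant<p zero             u<p _   = u<p
  invariant<p (suc zero)       _   v<p = v<p
  invariant<p (suc (suc zero)) {u} {v} _ _ = md<p (u * inv p v)

  invariant-ratio : ∀ o {α β γ δ} → AvoidsForm (+ α) (+ β) (+ γ) δ →
                    + α ≉ 0ℤ → + β ≉ 0ℤ → + γ ≉ 0ℤ →
                    Ratio (res (+ invariant o (div p β α) (div p γ α)))
  invariant-ratio zero {α} {β} {γ} av α≉0 β≉0 γ≉0 =
    avoids⇒ratio {+ α} {+ β} {+ γ} _ av α≉0 β≉0 γ≉0
      (≋-trans (*-congˡ (+ α) (ι-res (+ div p β α))) (*-div {β} {α} α≉0))
  invariant-ratio (suc zero) {α} {β} {γ} {δ} av α≉0 β≉0 γ≉0 =
    avoids⇒ratio {+ α} {+ γ} {+ β} {δ} _ (avoids-swap₂₃ {+ α} {+ β} {+ γ} av) α≉0 γ≉0 β≉0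
      (≋-trans (*-congˡ (+ α) (ι-res (+ div p γ α))) (*-div {γ} {α} α≉0))
  invariant-ratio (suc (suc zero)) {α} {β} {γ} {δ} av α≉0 β≉0 γ≉0 =
    avoids⇒ratio {+ γ} {+ β} {+ α} {δ} _
      (avoids-swap₁₂ {+ β} {+ γ} {+ α} (avoids-swap₂₃ {+ β} {+ α} {+ γ} (avoids-swap₁₂ {+ α} {+ β} {+ γ} av)))
      γ≉0 β≉0 α≉0
      (≋-trans (*-congˡ (+ γ) (ι-res (+ div p u v)))
        -- With r = u / v the chain is γ r ≋ α v r ≋ α u ≋ β, so r is the quotient of β by γ.
        (combine₃ (ℤ.- (+ div p u v)) (+ α) 1ℤ αv≋γ (*-div {u} {v} v≉0) (*-div {β} {α} α≉0)
          (eq (+ α) (+ β) (+ γ) (+ u) (+ v) (+ div p u v))))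
    where
    u = div p β α
    v = div p γ α
    αv≋γ = *-div {γ} {α} α≉0
    v≉0 : + v ≉ 0ℤ
    v≉0 v≋0 = γ≉0 (≋-trans (≋-sym αv≋γ) (≋-trans (*-congˡ (+ α) v≋0) (≋-reflexive (ℤ.*-zeroʳ (+ α)))))
    eq : ∀ α β γ u v r → γ ℤ.* r ℤ.- β ≡
         (ℤ.- r) ℤ.* (α ℤ.* v ℤ.- γ) ℤ.+ α ℤ.* (v ℤ.* r ℤ.- u) ℤ.+ 1ℤ ℤ.* (α ℤ.* u ℤ.- β)
    eq = ℤ-Solver.solve-∀

  -- Index sets of an admissible family avoided by the set.

  module _ {n : ℕ} (𝓔 : Family p n) (adm : Admissible 𝓔) (av : Avoids 𝓔 A) where

    avoidsForm : ∀ j → AvoidsForm (ι (a (𝓔 j))) (ι (b (𝓔 j))) (ι (c (𝓔 j))) (ι (d (𝓔 j)))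
    avoidsForm j {x} {y} {z} x∈ y∈ z∈ e =
      av j x y z (∈-elems⁻ A x∈) (∈-elems⁻ A y∈) (∈-elems⁻ A z∈)
        (+-injective-< (md<p (α * toℕ x + β * toℕ y + γ * toℕ z)) (toℕ<n (d (𝓔 j)))
          (≋-trans (+md (α * toℕ x + β * toℕ y + γ * toℕ z)) (≋-trans (≋-reflexive cast) e)))
      where
      α = toℕ (a (𝓔 j))
      β = toℕ (b (𝓔 j))
      γ = toℕ (c (𝓔 j))
      cast : + (α * toℕ x + β * toℕ y + γ * toℕ z) ≡ + α ℤ.* ι x ℤ.+ + β ℤ.* ι y ℤ.+ + γ ℤ.* ι z
      cast = trans (ℤ.pos-+ (α * toℕ x + β * toℕ y) (γ * toℕ z))
        (cong₂ ℤ._+_ (trans (ℤ.pos-+ (α * toℕ x) (β * toℕ y))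
          (cong₂ ℤ._+_ (ℤ.pos-* α (toℕ x)) (ℤ.pos-* β (toℕ y)))) (ℤ.pos-* γ (toℕ z)))

    value : Fin 3 → Fin 3 → Fin n → ℕ
    value k o j = invariant o (uk p k (𝓔 j)) (vk p k (𝓔 j))

    -- For each `k` the variables are permuted so that the `k`-th coefficient comes first and the
    -- other two keep the order in which `uk` and `vk` record them.
    value-ratio : ∀ k o j → Ratio (res (+ value k o j))
    value-ratio k o j with proj₁ adm j
    ... | a≢0 , b≢0 , c≢0 = go k
      where
      α = ι (a (𝓔 j))
      β = ι (b (𝓔 j))
      γ = ι (c (𝓔 j))
      δ = ι (d (𝓔 j))
      abc : AvoidsForm α β γ δ
      abc = avoidsForm j
      bac : AvoidsForm β α γ δ
      bac = avoids-swap₁₂ {α} {β} {γ} abc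
      cab : AvoidsForm γ α β δ
      cab = avoids-swap₁₂ {α} {γ} {β} (avoids-swap₂₃ {α} {β} {γ} abc)
      go : ∀ k → Ratio (res (+ value k o j))
      go zero             = invariant-ratio o abc (ι≉0 a≢0) (ι≉0 b≢0) (ι≉0 c≢0)
      go (suc zero)       = invariant-ratio o bac (ι≉0 b≢0) (ι≉0 a≢0) (ι≉0 c≢0)
      go (suc (suc zero)) = invariant-ratio o cab (ι≉0 c≢0) (ι≉0 a≢0) (ι≉0 b≢0)

    -- The values are reduced modulo `p` already, so `res` identifies no two different ones.
    value-res-injective : ∀ k o {i j} → res (+ value k o i) ≡ res (+ value k o j) → value k o i ≡ value k o j
    value-res-injective k o {i} {j} e = +-injective-< (value<p i) (value<p j) (res-injective {+ value k o i} {+ value k o j} e)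
      where
      value<p : ∀ i → value k o i ℕ.< p
      value<p i = invariant<p o (u<p k) (v<p k)
        where
        α = toℕ (a (𝓔 i))
        β = toℕ (b (𝓔 i))
        γ = toℕ (c (𝓔 i))
        u<p : ∀ k → uk p k (𝓔 i) ℕ.< p
        u<p zero             = md<p (β * inv p α)
        u<p (suc zero)       = md<p (α * inv p β)
        u<p (suc (suc zero)) = md<p (α * inv p γ)
        v<p : ∀ k → vk p k (𝓔 i) ℕ.< p
        v<p zero             = md<p (γ * inv p α)
        v<p (suc zero)       = md<p (γ * inv p β)
        v<p (suc (suc zero)) = md<p (β * inv p γ)

    -- The three alternatives of `GoodT*` are the cases `o` = 0, 1, 2 once `value` is unfolded.
    Distinguishes : Fin 3 → Subset n → Fin 3 → Fin n → Set
    Distinguishes k J o j = ∀ i → i ∈ₛ J → i ≢ j → value k o j ≢ value k o i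

    distinguishes? : ∀ k J o j → Dec (Distinguishes k J o j)
    distinguishes? k J o j = all? λ i → (i ∈? J) →-dec (¬? (i ≟ j) →-dec ¬? (value k o j ℕ.≟ value k o i))

    -- Each index of `J` lies in at least one of three possibly overlapping classes. An index of
    -- class `o` differs in `value k o` from every other index of `J`, so that value is injective on
    -- the class and `ratios-bound` applies to it; the factor 3 counts the classes.
    goodT*-bound : ∀ k J → GoodT* 𝓔 k J → ∣ J ∣ * N ^ 3 ≤ 3 * p ^ 3
    goodT*-bound k J good = begin
      ∣ J ∣ * N ^ 3
        ≡⟨ cong (_* N ^ 3) (trans (sym (length-elems J)) (trans (sym (*-identityʳ _)) (sym (∑-const (elems J) 1)))) ⟩
      ∑ (elems J) (λ _ → 1) * N ^ 3
        ≤⟨ *-monoˡ-≤ (N ^ 3) (∑-mono (elems J) some) ⟩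
      ∑ (elems J) (λ j → C zero j + (C (suc zero) j + C (suc (suc zero)) j)) * N ^ 3
        ≡⟨ cong (_* N ^ 3) (trans (∑-+ (elems J) _ _) (cong (λ m → ∑ (elems J) (C zero) + m) (∑-+ (elems J) _ _))) ⟩
      (∑ (elems J) (C zero) + (∑ (elems J) (C (suc zero)) + ∑ (elems J) (C (suc (suc zero))))) * N ^ 3
        ≡⟨ expand (∑ (elems J) (C zero)) (∑ (elems J) (C (suc zero))) (∑ (elems J) (C (suc (suc zero)))) (N ^ 3) ⟩
      ∑ (elems J) (C zero) * N ^ 3 + (∑ (elems J) (C (suc zero)) * N ^ 3 + ∑ (elems J) (C (suc (suc zero))) * N ^ 3)
        ≤⟨ +-mono-≤ (part zero) (+-mono-≤ (part (suc zero)) (part (suc (suc zero)))) ⟩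
      p ^ 3 + (p ^ 3 + p ^ 3)
        ≡⟨ cong (λ m → p ^ 3 + (p ^ 3 + m)) (+-identityʳ (p ^ 3)) ⟨
      3 * p ^ 3 ∎
      where
      open ≤-Reasoning
      C : Fin 3 → Fin n → ℕ
      C o j = ⟦ distinguishes? k J o j ⟧
      expand : ∀ x y z w → (x + (y + z)) * w ≡ x * w + (y * w + z * w)
      expand = solve-∀
      hit : ∀ o {j} → Distinguishes k J o j → 1 ≤ C o j
      hit o {j} h = ≤-reflexive (sym (⟦⟧-true (distinguishes? k J o j) h))
      some : ∀ {j} → j ∈ elems J → 1 ≤ C zero j + (C (suc zero) j + C (suc (suc zero)) j)
      some {j} j∈ with good j (∈-elems⁻ J j∈)
      ... | inj₁ h        = ≤-trans (hit zero h) (m≤m+n _ _)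
      ... | inj₂ (inj₁ h) = ≤-trans (hit (suc zero) h) (≤-trans (m≤m+n _ _) (m≤n+m _ (C zero j)))
      ... | inj₂ (inj₂ h) = ≤-trans (hit (suc (suc zero)) h) (≤-trans (m≤n+m _ (C (suc zero) j)) (m≤n+m _ (C zero j)))
      part : ∀ o → ∑ (elems J) (C o) * N ^ 3 ≤ p ^ 3
      part o = subst (λ m → m * N ^ 3 ≤ p ^ 3) (length-filter-∑ (distinguishes? k J o) (elems J))
        (ratios-bound (λ j → res (+ value k o j)) (filter⁺ (distinguishes? k J o) (elems-unique J)) injective (value-ratio k o))
        where
        injective : ∀ {i j} → i ∈ filter (distinguishes? k J o) (elems J) → j ∈ filter (distinguishes? k J o) (elems J) →
                    res (+ value k o i) ≡ res (+ value k o j) → i ≡ j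
        injective {i} {j} i∈ j∈ e with i ≟ j
        ... | yes i≡j = i≡j
        ... | no  i≢j = contradiction (sym (value-res-injective k o {i} {j} e))
          (proj₂ (∈-filter⁻ (distinguishes? k J o) {xs = elems J} j∈) i
            (∈-elems⁻ J (proj₁ (∈-filter⁻ (distinguishes? k J o) {xs = elems J} i∈))) i≢j)

goodT⇒goodT* : ∀ {p n} (𝓔 : Family p n) k J → GoodT 𝓔 k J → GoodT* 𝓔 k J
goodT⇒goodT* 𝓔 k J good j j∈ = inj₁ λ i i∈ i≢j → proj₁ (good j i j∈ i∈ (i≢j ∘ sym))

-- Fractional exponents cleared to integer powers.

^-distribʳ-* : ∀ n x y → (x * y) ^ n ≡ x ^ n * y ^ n
^-distribʳ-* zero    x y = refl
^-distribʳ-* (suc n) x y = trans (cong (x * y *_) (^-distribʳ-* n x y)) (interchange x y (x ^ n) (y ^ n))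
  where
  interchange : ∀ a b c d → a * b * (c * d) ≡ a * c * (b * d)
  interchange = solve-∀

^-*-cubes : ∀ m x n → m ^ n * x ^ (3 * n) ≡ (m * x ^ 3) ^ n
^-*-cubes m x n = trans (cong (m ^ n *_) (sym (^-*-assoc x 3 n))) (sym (^-distribʳ-* n m (x ^ 3)))

-- The `a`-th power of the cubic bound uses up 3a of the `b` factors N; the remaining b - 3a are
-- bounded by p. This is the cubic bound weakened to an exponent a/b of at most 1/3.
cube-bound-^ : ∀ {t N p} a b → t * N ^ 3 ≤ 3 * p ^ 3 → N ≤ p → 3 * a ≤ b →
               N ^ b * t ^ a ≤ 3 ^ b * p ^ b
cube-bound-^ {t} {N} {p} a b tN³≤ N≤p 3a≤b = begin
  N ^ b * t ^ a                     ≡⟨ cong (λ m → N ^ m * t ^ a) (m+[n∸m]≡n 3a≤b) ⟨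
  N ^ (3 * a + r) * t ^ a           ≡⟨ cong (_* t ^ a) (^-distribˡ-+-* N (3 * a) r) ⟩
  N ^ (3 * a) * N ^ r * t ^ a       ≡⟨ swap (N ^ (3 * a)) (N ^ r) (t ^ a) ⟩
  t ^ a * N ^ (3 * a) * N ^ r       ≡⟨ cong (_* N ^ r) (^-*-cubes t N a) ⟩
  (t * N ^ 3) ^ a * N ^ r           ≤⟨ *-mono-≤ (^-monoˡ-≤ a tN³≤) (^-monoˡ-≤ r N≤p) ⟩
  (3 * p ^ 3) ^ a * p ^ r           ≡⟨ cong (_* p ^ r) (^-*-cubes 3 p a) ⟨
  3 ^ a * p ^ (3 * a) * p ^ r       ≡⟨ *-assoc (3 ^ a) (p ^ (3 * a)) (p ^ r) ⟩
  3 ^ a * (p ^ (3 * a) * p ^ r)     ≡⟨ cong (3 ^ a *_) (^-distribˡ-+-* p (3 * a) r) ⟨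
  3 ^ a * p ^ (3 * a + r)           ≡⟨ cong (λ m → 3 ^ a * p ^ m) (m+[n∸m]≡n 3a≤b) ⟩
  3 ^ a * p ^ b                     ≤⟨ *-monoˡ-≤ (p ^ b) (^-monoʳ-≤ 3 (≤-trans (m≤n*m a 3) 3a≤b)) ⟩
  3 ^ b * p ^ b                     ∎
  where
  open ≤-Reasoning
  r = b ∸ 3 * a
  swap : ∀ x y z → x * y * z ≡ z * x * y
  swap = solve-∀

-- The product of the `s`-th power of the cubic bound, the `w`-th power of N⁵ ≤ p X and the `r`-th
-- power of N ≤ p, with p^w multiplied into both sides.
energy-bound-^ : ∀ {t N p X} r s w → t * N ^ 3 ≤ 3 * p ^ 3 → N ≤ p → N ^ 5 ≤ p * X →
                 N ^ (3 * s + (5 * w + r)) * t ^ s * p ^ w ≤ 3 ^ s * p ^ (3 * s + (w + (w + r))) * X ^ w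
energy-bound-^ {t} {N} {p} {X} r s w tN³≤ N≤p N⁵≤ = begin
  N ^ (3 * s + (5 * w + r)) * t ^ s * p ^ w
    ≡⟨ cong (λ m → m * t ^ s * p ^ w) (trans (^-distribˡ-+-* N (3 * s) _) (cong (N ^ (3 * s) *_) (^-distribˡ-+-* N (5 * w) r))) ⟩
  N ^ (3 * s) * (N ^ (5 * w) * N ^ r) * t ^ s * p ^ w
    ≡⟨ lhs (N ^ (3 * s)) (N ^ (5 * w)) (N ^ r) (t ^ s) (p ^ w) ⟩
  t ^ s * N ^ (3 * s) * (N ^ (5 * w) * (N ^ r * p ^ w))
    ≡⟨ cong₂ (λ m n → m * (n * (N ^ r * p ^ w))) (^-*-cubes t N s) (sym (^-*-assoc N 5 w)) ⟩
  (t * N ^ 3) ^ s * ((N ^ 5) ^ w * (N ^ r * p ^ w))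
    ≤⟨ *-mono-≤ (^-monoˡ-≤ s tN³≤) (*-mono-≤ (^-monoˡ-≤ w N⁵≤) (*-monoˡ-≤ (p ^ w) (^-monoˡ-≤ r N≤p))) ⟩
  (3 * p ^ 3) ^ s * ((p * X) ^ w * (p ^ r * p ^ w))
    ≡⟨ cong₂ (λ m n → m * (n * (p ^ r * p ^ w))) (sym (^-*-cubes 3 p s)) (^-distribʳ-* w p X) ⟩
  3 ^ s * p ^ (3 * s) * (p ^ w * X ^ w * (p ^ r * p ^ w))
    ≡⟨ rhs (3 ^ s) (p ^ (3 * s)) (p ^ w) (X ^ w) (p ^ r) ⟩
  3 ^ s * (p ^ (3 * s) * (p ^ w * (p ^ w * p ^ r))) * X ^ w
    ≡⟨ cong (λ m → 3 ^ s * m * X ^ w) (trans (^-distribˡ-+-* p (3 * s) _) (cong (p ^ (3 * s) *_)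
         (trans (^-distribˡ-+-* p w _) (cong (p ^ w *_) (^-distribˡ-+-* p w r))))) ⟨
  3 ^ s * p ^ (3 * s + (w + (w + r))) * X ^ w ∎
  where
  open ≤-Reasoning
  lhs : ∀ a b c d e → a * (b * c) * d * e ≡ d * a * (b * (c * e))
  lhs = solve-∀
  rhs : ∀ a b c d e → a * b * (c * d * (e * c)) ≡ a * (b * (c * (c * e))) * d
  rhs = solve-∀

energy-bound : ∀ {t N p X} a b → 159 * a ≤ 35 * b → 1 ≤ t →
               t * N ^ 3 ≤ 3 * p ^ 3 → N ≤ p → N ^ 5 ≤ p * X →
               N ^ (159 * b) * t ^ (159 * a) * p ^ (22 * b) * N ^ (66 * b)
                 ≤ 3 ^ (159 * b) * p ^ (159 * b) * X ^ (22 * b)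
energy-bound {suc t′} {N} {p} {X} a b 159a≤35b _ tN³≤ N≤p N⁵≤ = begin
  N ^ (159 * b) * t ^ (159 * a) * p ^ (22 * b) * N ^ (66 * b)
    -- The hypothesis on a/b enters here: since `t` is positive, its exponent may be raised to 35b.
    ≤⟨ *-monoˡ-≤ (N ^ (66 * b)) (*-monoˡ-≤ (p ^ (22 * b)) (*-monoʳ-≤ (N ^ (159 * b)) (^-monoʳ-≤ t 159a≤35b))) ⟩
  N ^ (159 * b) * t ^ (35 * b) * p ^ (22 * b) * N ^ (66 * b)
    ≡⟨ swap (N ^ (159 * b)) (t ^ (35 * b)) (p ^ (22 * b)) (N ^ (66 * b)) ⟩
  N ^ (159 * b) * N ^ (66 * b) * t ^ (35 * b) * p ^ (22 * b)
    ≡⟨ cong (λ m → m * t ^ (35 * b) * p ^ (22 * b)) (trans (sym (^-distribˡ-+-* N (159 * b) (66 * b))) (cong (N ^_) (e₁ b))) ⟩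
  N ^ (3 * (35 * b) + (5 * (22 * b) + 10 * b)) * t ^ (35 * b) * p ^ (22 * b)
    -- The exponents of `t` and `X` dictate s = 35b and w = 22b. Then 159 + 66 = 3 · 35 + 5 · 22 +
    -- 10 leaves r = 10b, and the powers of p add up to 105 + 22 + 22 + 10 = 159.
    ≤⟨ energy-bound-^ (10 * b) (35 * b) (22 * b) tN³≤ N≤p N⁵≤ ⟩
  3 ^ (35 * b) * p ^ (3 * (35 * b) + (22 * b + (22 * b + 10 * b))) * X ^ (22 * b)
    ≡⟨ cong (λ m → 3 ^ (35 * b) * p ^ m * X ^ (22 * b)) (e₂ b) ⟩
  3 ^ (35 * b) * p ^ (159 * b) * X ^ (22 * b)
    ≤⟨ *-monoˡ-≤ (X ^ (22 * b)) (*-monoˡ-≤ (p ^ (159 * b)) (^-monoʳ-≤ 3 (*-monoˡ-≤ b (m≤m+n 35 124)))) ⟩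
  3 ^ (159 * b) * p ^ (159 * b) * X ^ (22 * b) ∎
  where
  open ≤-Reasoning
  t = suc t′
  swap : ∀ x y z w → x * y * z * w ≡ x * w * y * z
  swap = solve-∀
  e₁ : ∀ b → 159 * b + 66 * b ≡ 3 * (35 * b) + (5 * (22 * b) + 10 * b)
  e₁ = solve-∀
  e₂ : ∀ b → 3 * (35 * b) + (22 * b + (22 * b + 10 * b)) ≡ 159 * b
  e₂ = solve-∀

-- Bounds in terms of the cardinality, and the final assembly.

goodT*⇒card-bound : ∀ {p n} → Prime p → (E : Family p n) → Admissible E → (A : Subset p) → Avoids E A →
                    ∀ k J → GoodT* E k J → ∣ J ∣ * ∣ A ∣ ^ 3 ≤ 3 * p ^ 3
goodT*⇒card-bound {zero}  pr = contradiction pr ¬prime[0]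
goodT*⇒card-bound {suc q} pr E adm A av k J good =
  subst (λ m → ∣ J ∣ * m ^ 3 ≤ 3 * suc q ^ 3) (length-elems A) (Energies.goodT*-bound q pr A E adm av k J good)

Eplus-lower-bound : ∀ {p n} → Prime p → (E : Family p (suc n)) → Admissible E → (A : Subset p) → Avoids E A →
                    ∣ A ∣ ^ 5 ≤ p * (p * Eplus A ∸ ∣ A ∣ ^ 4)
Eplus-lower-bound {zero}  pr = contradiction pr ¬prime[0]
Eplus-lower-bound {suc q} pr E adm A av =
  subst (λ m → m ^ 5 ≤ suc q * (suc q * Eplus A ∸ m ^ 4)) (length-elems A)
    -- Any one avoided equation suffices; the first of the nonempty family is used, through its
    -- quotient b / a.
    (Energies.Eplus-excess q pr A (Energies.value-ratio q pr A E adm av zero zero zero))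

theorem31 :
  Σ ℕ λ c₀ → (1 ≤ c₀) ×
    -- (1a) kappa1 = a/b < 10/31 :  |A| <= C p / T^(a/b)
    (((a b : ℕ) → 1 ≤ b → 31 * a < 10 * b →
      Σ ℕ λ C → (p : ℕ) → Prime p → (n : ℕ) (E : Family p n) → Admissible E →
      (A : Subset p) → Avoids E A →
      c₀ ^ 47 * p ^ 39 ≤ ∣ A ∣ ^ 47 →
      (t : ℕ) → IsT E t →
      ∣ A ∣ ^ b * t ^ a ≤ C ^ b * p ^ b) ×
    -- (1b) kappa2 = a/b < 3/10 :  |A| <= C p / T_*^(a/b)
    ((a b : ℕ) → 1 ≤ b → 10 * a < 3 * b →
      Σ ℕ λ C → (p : ℕ) → Prime p → (n : ℕ) (E : Family p n) → Admissible E →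
      (A : Subset p) → Avoids E A →
      c₀ ^ 47 * p ^ 39 ≤ ∣ A ∣ ^ 47 →
      (t : ℕ) → IsT* E t →
      ∣ A ∣ ^ b * t ^ a ≤ C ^ b * p ^ b) ×
    -- (2) kappa3 = a/b < 35/159
    ((a b : ℕ) → 1 ≤ b → 159 * a < 35 * b →
      Σ ℕ λ C → (p : ℕ) → Prime p → (n : ℕ) (E : Family p n) → Admissible E →
      (A : Subset p) → Avoids E A →
      c₀ ^ 9 * p ^ 7 ≤ ∣ A ∣ ^ 9 →
      (t : ℕ) → IsT* E t → t ^ 3 < p ^ 2 →
      -- |A| <= C p T_*^(-a/b) (E*/|A|^3)^(22/159), with p E* = p E^+ - |A|^4,
      -- raised to the power 159 b
      (∣ A ∣ ^ (159 * b) * t ^ (159 * a) * p ^ (22 * b) * ∣ A ∣ ^ (66 * b)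
         ≤ C ^ (159 * b) * p ^ (159 * b) * (p * Eplus A ∸ ∣ A ∣ ^ 4) ^ (22 * b))
      ⊎
      -- |A| <= C p / T_*^(69/183), raised to the power 183
      (∣ A ∣ ^ 183 * t ^ 69 ≤ C ^ 183 * p ^ 183)))
theorem31 = 1 , ≤-refl
  -- The constant 3 is the number of classes in `goodT*-bound`. From 30a ≤ 31a < 10b follows 3a ≤ b,
  -- and a set good for T is good for T_*.
  , (λ a b _ 31a<10b → 3 , λ p pr n E adm A av _ t ((k , J , good , ∣J∣≡t) , _) →
      cube-bound-^ a b (T*-bound pr E adm A av k J (goodT⇒goodT* E k J good) ∣J∣≡t) (∣p∣≤n A)
        (*-cancelˡ-≤ 10 (≤-trans (≤-reflexive (sym (*-assoc 10 3 a)))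
          (≤-trans (*-monoˡ-≤ a (n≤1+n 30)) (<⇒≤ 31a<10b)))))
  -- Here 9a ≤ 10a < 3b gives 3a ≤ b.
  , (λ a b _ 10a<3b → 3 , λ p pr n E adm A av _ t ((k , J , good , ∣J∣≡t) , _) →
      cube-bound-^ a b (T*-bound pr E adm A av k J good ∣J∣≡t) (∣p∣≤n A)
        (*-cancelˡ-≤ 3 (≤-trans (≤-reflexive (sym (*-assoc 3 3 a)))
          (≤-trans (*-monoˡ-≤ a (n≤1+n 9)) (<⇒≤ 10a<3b)))))
  , (λ a b _ 159a<35b → 3 , part₂ a b (<⇒≤ 159a<35b))
  where
  T*-bound : ∀ {p n t} → Prime p → (E : Family p n) → Admissible E → (A : Subset p) → Avoids E A →
             ∀ k J → GoodT* E k J → ∣ J ∣ ≡ t → t * ∣ A ∣ ^ 3 ≤ 3 * p ^ 3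
  T*-bound pr E adm A av k J good refl = goodT*⇒card-bound pr E adm A av k J good

  -- For `t` = 0 the second alternative is trivial, since `t ^ 69` vanishes. For positive `t` the
  -- index set `J` is nonempty, hence so is the family; `Eplus-lower-bound` then has an equation to
  -- work with, and the first alternative follows.
  part₂ : ∀ a b → 159 * a ≤ 35 * b →
          (p : ℕ) → Prime p → (n : ℕ) (E : Family p n) → Admissible E →
          (A : Subset p) → Avoids E A → 1 ^ 9 * p ^ 7 ≤ ∣ A ∣ ^ 9 →
          (t : ℕ) → IsT* E t → t ^ 3 < p ^ 2 →
          (∣ A ∣ ^ (159 * b) * t ^ (159 * a) * p ^ (22 * b) * ∣ A ∣ ^ (66 * b)
             ≤ 3 ^ (159 * b) * p ^ (159 * b) * (p * Eplus A ∸ ∣ A ∣ ^ 4) ^ (22 * b))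
          ⊎ (∣ A ∣ ^ 183 * t ^ 69 ≤ 3 ^ 183 * p ^ 183)
  part₂ a b _ p pr n E adm A av _ zero _ _ =
    inj₂ (≤-trans (≤-reflexive (*-zeroʳ (∣ A ∣ ^ 183))) z≤n)
  part₂ a b _ p pr zero E adm A av _ (suc t) ((_ , J , _ , ∣J∣≡t) , _) _ =
    contradiction (subst (_≤ 0) ∣J∣≡t (∣p∣≤n J)) λ ()
  part₂ a b 159a≤35b p pr (suc n) E adm A av _ (suc t) ((k , J , good , ∣J∣≡t) , _) _ =
    inj₁ (energy-bound {suc t} a b 159a≤35b (s≤s z≤n) (T*-bound pr E adm A av k J good ∣J∣≡t)
      (∣p∣≤n A) (Eplus-lower-bound pr E adm A av))
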